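{- The set $I_{TD^+} = \{e : \mathrm{TD}^+(\mathcal L_e) < \infty\}$ is $\Sigma^0_5$-complete.
   Context: $W_0,W_1,\ldots$ is an acceptable numbering of all r.e. subsets of $\mathbb N$; $L^e_j = \{x : \langle j,x\rangle \in W_e\}$ and $\mathcal L_e = \{L^e_j : j\in\mathbb N\}$. For a family $\mathcal L$ of subsets of $\mathbb N$ and $L\in\mathcal L$, a positive teaching set for $L$ w.r.t. $\mathcal L$ is a set $S\subseteq L$ such that no $L'\in\mathcal L\setminus\{L\}$ satisfies $S\subseteq L'$; $\mathrm{TD}^+(L,\mathcal L)$ is the smallest size of such a set ($\infty$ if there is no finite one), and $\mathrm{TD}^+(\mathcal L)=\sup\{\mathrm{TD}^+(L,\mathcal L):L\in\mathcal L\}$. $\Sigma^0_n$-complete means definable by a $\Sigma^0_n$ formula and every $\Sigma^0_n$ set many-one reduces to it via a recursive function. -}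

module Defs where

open import Level using (0ℓ)
open import Data.Nat using (ℕ; zero; suc; _+_; _≤_)
open import Data.Fin using (Fin)
open import Data.Vec using (Vec; []; _∷_; lookup)
open import Data.Maybe using (Maybe; just; nothing; _>>=_)
open import Data.Product using (Σ; ∃; _×_; _,_)
open import Data.List using (List; length)
open import Data.List.Relation.Unary.All using (All)
open import Relation.Binary.PropositionalEquality using (_≡_)
open import Relation.Nullary using (¬_)
open import Function.Bundles using (_⇔_)

data PR : ℕ → Set where
  zer  : ∀ {n} → PR n
  succ : PR 1
  proj : ∀ {n} → Fin n → PR n
  comp : ∀ {m n} → PR m → Vec (PR n) m → PR n
  prec : ∀ {n} → PR n → PR (suc (suc n)) → PR (suc n)
  mu   : ∀ {n} → PR (suc n) → PR n

mutual
  eval : ∀ {n} → ℕ → PR n → Vec ℕ n → Maybe ℕ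
  eval zero _ _ = nothing
  eval (suc k) zer xs = just 0
  eval (suc k) succ (x ∷ []) = just (suc x)
  eval (suc k) (proj i) xs = just (lookup xs i)
  eval (suc k) (comp f gs) xs = evalVec k gs xs >>= eval k f
  eval (suc k) (prec f g) (zero ∷ xs) = eval k f xs
  eval (suc k) (prec f g) (suc y ∷ xs) =
    eval k (prec f g) (y ∷ xs) >>= λ r → eval k g (y ∷ r ∷ xs)
  eval (suc k) (mu f) xs = search k f xs 0

  evalVec : ∀ {m n} → ℕ → Vec (PR n) m → Vec ℕ n → Maybe (Vec ℕ m)
  evalVec k [] xs = just []
  evalVec k (g ∷ gs) xs =
    eval k g xs >>= λ y → evalVec k gs xs >>= λ ys → just (y ∷ ys)

  search : ∀ {n} → ℕ → PR (suc n) → Vec ℕ n → ℕ → Maybe ℕ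
  search zero f xs y = nothing
  search (suc k) f xs y = eval k f (y ∷ xs) >>= searchStep k f xs y

  searchStep : ∀ {n} → ℕ → PR (suc n) → Vec ℕ n → ℕ → ℕ → Maybe ℕ
  searchStep k f xs y zero = just y
  searchStep k f xs y (suc _) = search k f xs (suc y)

-- Cantor pairing  ⟨x,y⟩ = (x+y)(x+y+1)/2 + y  and its inverse.

tri : ℕ → ℕ
tri zero = zero
tri (suc k) = suc k + tri k

pair : ℕ → ℕ → ℕ
pair x y = tri (x + y) + y

unpairStep : ℕ × ℕ → ℕ × ℕ
unpairStep (zero , y) = suc y , zero
unpairStep (suc x , y) = x , suc y

unpair : ℕ → ℕ × ℕ
unpair zero = zero , zero
unpair (suc n) = unpairStep (unpair n)

-- Gödel numbering of codes (surjective, effective).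

clampFin : (n : ℕ) → ℕ → Fin (suc n)
clampFin n zero = Fin.zero
clampFin zero (suc a) = Fin.zero
clampFin (suc n) (suc a) = Fin.suc (clampFin n a)

mutual
  decode : ℕ → (n : ℕ) → ℕ → PR n
  decode zero n e = zer
  decode (suc k) n e = decodeTag k n (unpair e)

  decodeTag : ℕ → (n : ℕ) → ℕ × ℕ → PR n
  decodeTag k n (zero , a) = zer
  decodeTag k (suc zero) (suc zero , a) = succ
  decodeTag k (suc (suc n)) (suc zero , a) = zer
  decodeTag k zero (suc zero , a) = zer
  decodeTag k zero (suc (suc zero) , a) = zer
  decodeTag k (suc n) (suc (suc zero) , a) = proj (clampFin n a)
  decodeTag k n (suc (suc (suc zero)) , a) = decodeComp k n (unpair a)
  decodeTag k zero (suc (suc (suc (suc zero))) , a) = zer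
  decodeTag k (suc n) (suc (suc (suc (suc zero))) , a) = decodePrec k n (unpair a)
  decodeTag k n (suc (suc (suc (suc (suc zero)))) , a) = mu (decode k (suc n) a)
  decodeTag k n (suc (suc (suc (suc (suc (suc _))))) , a) = zer

  decodeComp : ℕ → (n : ℕ) → ℕ × ℕ → PR n
  decodeComp k n (m , r) = decodeComp′ k n m (unpair r)

  decodeComp′ : ℕ → (n : ℕ) → ℕ → ℕ × ℕ → PR n
  decodeComp′ k n m (fc , gcs) = comp (decode k m fc) (decodeVec k m n gcs)

  decodePrec : ℕ → (n : ℕ) → ℕ × ℕ → PR (suc n)
  decodePrec k n (fc , gc) = prec (decode k n fc) (decode k (suc (suc n)) gc)

  decodeVec : ℕ → (m n : ℕ) → ℕ → Vec (PR n) m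
  decodeVec k zero n c = []
  decodeVec k (suc m) n c = decodeVecStep k m n (unpair c)

  decodeVecStep : ℕ → (m n : ℕ) → ℕ × ℕ → Vec (PR n) (suc m)
  decodeVecStep k m n (h , t) = decode k n h ∷ decodeVec k m n t

code : (n : ℕ) → ℕ → PR n
code n e = decode (suc e) n e

W : ℕ → ℕ → Set
W e x = ∃ λ fuel → ∃ λ y → eval fuel (code 1 e) (x ∷ []) ≡ just y

-- L^e_j = { x : ⟨j,x⟩ ∈ W_e },  𝓛_e = { L^e_j : j ∈ ℕ }
L : ℕ → ℕ → ℕ → Set
L e j x = W e (pair j x)

_≐_ : (ℕ → Set) → (ℕ → Set) → Set
A ≐ B = ∀ x → A x ⇔ B x

-- S (a finite set, listed) is a positive teaching set for L^e_j w.r.t. 𝓛_e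
IsPosTeachingSet : ℕ → ℕ → List ℕ → Set
IsPosTeachingSet e j S =
  All (L e j) S × (∀ j′ → ¬ (All (L e j′) S × ¬ (L e j′ ≐ L e j)))

TD⁺≤ : ℕ → ℕ → ℕ → Set
TD⁺≤ e j k = ∃ λ (S : List ℕ) → length S ≤ k × IsPosTeachingSet e j S

-- TD⁺(𝓛_e) < ∞  (the supremum over all members is finite)
TD⁺Finite : ℕ → Set
TD⁺Finite e = ∃ λ k → ∀ j → TD⁺≤ e j k

I-TD⁺ : ℕ → Set
I-TD⁺ e = TD⁺Finite e

Total : ∀ {n} → PR n → Set
Total {n} c = ∀ (xs : Vec ℕ n) → ∃ λ fuel → ∃ λ y → eval fuel c xs ≡ just y

Recursive : (ℕ → ℕ) → Set
Recursive f = ∃ λ (c : PR 1) → ∀ x → ∃ λ fuel → eval fuel c (x ∷ []) ≡ just (f x)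

-- the recursive relation decided by a total code: R(v) iff c(v) = 0
Holds : ∀ {n} → PR n → Vec ℕ n → Set
Holds c xs = ∃ λ fuel → eval fuel c xs ≡ just 0

Σ⁰₅ : (ℕ → Set) → Set
Σ⁰₅ A = ∃ λ (c : PR 6) → Total c ×
  (∀ x → A x ⇔
     (∃ λ a → ∀ b → ∃ λ c′ → ∀ d → ∃ λ e →
        Holds c (x ∷ a ∷ b ∷ c′ ∷ d ∷ e ∷ [])))

_≤m_ : (ℕ → Set) → (ℕ → Set) → Set
B ≤m A = ∃ λ f → Recursive f × (∀ x → B x ⇔ A (f x))

Σ⁰₅-complete : (ℕ → Set) → Set₁
Σ⁰₅-complete A = Σ⁰₅ A × (∀ (B : ℕ → Set) → Σ⁰₅ B → B ≤m A)

module Submission where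

-- Membership.  TD⁺(𝓛_e) ≤ k says that every member j has a set S with |S| ≤ k, S ⊆ L_j and
-- S ⊆ L_j′ ⇒ L_j′ = L_j for all j′.  The inclusions in S ⊆ L are Σ₁ and the equality is Π₂, so
-- the quantifiers ∃k ∀j ∃S ∀∃ suffice, once halting is decided stepwise by a universal machine.
--
-- Hardness.  Let B x ⇔ ∃a ∀b Q(a,b) with Q(a,b) = ∃c ∀d ∃e R.  For every tuple β the family has a
-- separate block.  Its main language contains all points ⟨i,n⟩; the attacker with index (i,p,s)
-- contains the points ⟨i′,n⟩ with i′ ≠ i and n ≤ p, and a private point of its own.  The attacker
-- collapses to the main language as soon as ∃a<i ∃c<p ∀d<s ∃e R(x,a,β_a,c,d,e), which is Σ₁; private
-- points of collapsed attackers are put into all languages of the block.  Uncollapsed attackers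
-- are taught by their private points.  If ∀b Q(a,b), the a+1 points ⟨0,c+1⟩, …, ⟨a,c+1⟩ force
-- i > a and p > c and hence teach the main language.  Conversely, a teaching set with k points
-- misses a column i ≤ k and is contained in the attackers (i,p,s) for some p and all s, so these
-- all collapse, and the pigeonhole principle gives ∃a<i Q(a,β_a); as β is arbitrary, some a
-- satisfies ∀b Q(a,b).

open import Level using (0ℓ)
open import Axiom.ExcludedMiddle using (ExcludedMiddle)
open import Axiom.DoubleNegationElimination using (em⇒dne)
open import Defs
open import Data.Fin using (Fin; toℕ)
open import Data.Fin.Patterns
open import Data.Fin.Properties using (pigeonhole; toℕ-injective; toℕ<n; all?; ¬∀⟶∃¬)
  renaming (<⇒≢ to <⇒≢ᶠ)
open import Data.List using (List; []; _∷_; length; map; applyUpTo)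
import Data.List as List
open import Data.List.Properties using (length-map; length-applyUpTo)
open import Data.List.Relation.Unary.All as All using (All; []; _∷_)
open import Data.List.Relation.Unary.All.Properties
  using (applyUpTo⁺₁; applyUpTo⁻; ¬Any⇒All¬; map⁻)
open import Data.List.Relation.Unary.Any using (index)
open import Data.List.Relation.Unary.Any.Properties using (lookup-index)
open import Data.Maybe using (Maybe; just; _>>=_)
open import Data.Maybe.Properties using (just-injective)
open import Data.Nat
open import Data.Nat.Properties
open import Data.List.Membership.DecPropositional _≟_ using (_∈_; _∉_; _∈?_)
open import Data.Product using (∃; _×_; _,_; proj₁; proj₂)
open import Data.Sum using (_⊎_; inj₁; inj₂)
open import Data.Unit using (⊤; tt)
open import Data.Vec using (Vec; []; _∷_; lookup; tabulate)
open import Data.Vec.Properties using (tabulate∘lookup)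
open import Function using (_∘_; id)
open import Function.Bundles using (_⇔_; mk⇔; module Equivalence)
open import Relation.Binary.PropositionalEquality
  using (_≡_; _≢_; refl; sym; trans; cong; cong₂; subst; subst₂; module ≡-Reasoning)
open import Relation.Nullary using (¬_; yes; no; contradiction)
open Equivalence using (to; from)

private variable
  m n : ℕ

-- Pairing

pair-zeroʳ : ∀ x → pair (suc x) 0 ≡ suc (pair 0 x)
pair-zeroʳ x = begin
  tri (suc x + 0) + 0   ≡⟨ +-identityʳ _ ⟩
  tri (suc x + 0)       ≡⟨ cong tri (+-identityʳ (suc x)) ⟩
  suc x + tri x         ≡⟨ cong suc (+-comm x (tri x)) ⟩
  suc (tri x + x)       ∎
  where open ≡-Reasoning

pair-sucʳ : ∀ x y → pair x (suc y) ≡ suc (pair (suc x) y)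
pair-sucʳ x y = trans (cong (λ s → tri s + suc y) (+-suc x y)) (+-suc _ y)

-- `unpair` walks along each antidiagonal with y increasing, and from (0,y) to the start of the next
-- one. Hence the recursion on the sum s first and on y within it.
unpair-pair : ∀ x y → unpair (pair x y) ≡ (x , y)
unpair-pair x y = go (x + y) y x refl
  where
  go : ∀ s y x → x + y ≡ s → unpair (pair x y) ≡ (x , y)
  go s zero zero eq = refl
  go (suc s) zero (suc x) eq =
    trans (cong unpair (pair-zeroʳ x))
          (cong unpairStep (go s x 0 (trans (sym (+-identityʳ x)) (suc-injective eq))))
  go s (suc y) x eq =
    trans (cong unpair (pair-sucʳ x y))
          (cong unpairStep (go s y (suc x) (trans (sym (+-suc x y)) eq)))

pair-unpair : ∀ n → pair (proj₁ (unpair n)) (proj₂ (unpair n)) ≡ n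
pair-unpair zero = refl
pair-unpair (suc n) with unpair n | pair-unpair n
... | zero  , y | eq = trans (pair-zeroʳ y) (cong suc eq)
... | suc x , y | eq = trans (pair-sucʳ x y) (cong suc eq)

π₁ π₂ : ℕ → ℕ
π₁ z = proj₁ (unpair z)
π₂ z = proj₂ (unpair z)

m≤tri : ∀ m → m ≤ tri m
m≤tri zero    = z≤n
m≤tri (suc m) = m≤m+n (suc m) (tri m)

-- An opaque copy of pair: unfolding pair during conversion checking duplicates its arguments.
opaque
  ⟪_,_⟫ : ℕ → ℕ → ℕ
  ⟪_,_⟫ = pair

  ⟪⟫≡pair : ∀ x y → ⟪ x , y ⟫ ≡ pair x y
  ⟪⟫≡pair x y = refl

  unpair-⟪⟫ : ∀ x y → unpair ⟪ x , y ⟫ ≡ (x , y)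
  unpair-⟪⟫ = unpair-pair

  m≤⟪m,n⟫ : ∀ m n → m ≤ ⟪ m , n ⟫
  m≤⟪m,n⟫ m n = ≤-trans (m≤m+n m n) (≤-trans (m≤tri (m + n)) (m≤m+n _ n))

  n≤⟪m,n⟫ : ∀ m n → n ≤ ⟪ m , n ⟫
  n≤⟪m,n⟫ m n = m≤n+m n (tri (m + n))

  n<⟪1+m,n⟫ : ∀ m n → n < ⟪ suc m , n ⟫
  n<⟪1+m,n⟫ m n = +-monoˡ-≤ n (s≤s z≤n)

π₁-⟪⟫ : ∀ x y → π₁ ⟪ x , y ⟫ ≡ x
π₁-⟪⟫ x y = cong proj₁ (unpair-⟪⟫ x y)

π₂-⟪⟫ : ∀ x y → π₂ ⟪ x , y ⟫ ≡ y
π₂-⟪⟫ x y = cong proj₂ (unpair-⟪⟫ x y)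

-- A number codes an infinite sequence without a length; `tuple` prescribes only an initial segment
-- of it.
nth : ℕ → ℕ → ℕ
nth σ zero    = π₁ σ
nth σ (suc i) = nth (π₂ σ) i

tuple : ∀ n (f : ℕ → ℕ) → ∃ λ σ → ∀ i → i < n → nth σ i ≡ f i
tuple zero    f = 0 , λ _ ()
tuple (suc n) f with tuple n (f ∘ suc)
... | σ , eq = ⟪ f 0 , σ ⟫ , go
  where
  go : ∀ i → i < suc n → nth ⟪ f 0 , σ ⟫ i ≡ f i
  go zero    _         = π₁-⟪⟫ (f 0) σ
  go (suc i) (s≤s i<n) = trans (cong (λ τ → nth τ i) (π₂-⟪⟫ (f 0) σ)) (eq i i<n)

-- Big-step semantics

infix 4 _[_]⇓_ _[_]⇓*_
infixr 5 _∷⇓_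

mutual
  data _[_]⇓_ : PR n → Vec ℕ n → ℕ → Set where
    zer⇓   : ∀ {xs : Vec ℕ n} → zer [ xs ]⇓ 0
    succ⇓  : ∀ {x} → succ [ x ∷ [] ]⇓ suc x
    proj⇓  : ∀ {i} {xs : Vec ℕ n} → proj i [ xs ]⇓ lookup xs i
    comp⇓  : ∀ {f : PR m} {gs} {xs : Vec ℕ n} {ys y} →
             gs [ xs ]⇓* ys → f [ ys ]⇓ y → comp f gs [ xs ]⇓ y
    prec₀⇓ : ∀ {f : PR n} {g xs y} → f [ xs ]⇓ y → prec f g [ 0 ∷ xs ]⇓ y
    precₛ⇓ : ∀ {f : PR n} {g xs i r y} → prec f g [ i ∷ xs ]⇓ r →
             g [ i ∷ r ∷ xs ]⇓ y → prec f g [ suc i ∷ xs ]⇓ y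
    mu⇓    : ∀ {f : PR (suc n)} {xs y} → Search f xs 0 y → mu f [ xs ]⇓ y

  data _[_]⇓*_ : Vec (PR n) m → Vec ℕ n → Vec ℕ m → Set where
    []⇓ : ∀ {xs : Vec ℕ n} → [] [ xs ]⇓* []
    _∷⇓_ : ∀ {g : PR n} {gs : Vec (PR n) m} {xs y ys} →
           g [ xs ]⇓ y → gs [ xs ]⇓* ys → g ∷ gs [ xs ]⇓* y ∷ ys

  data Search (f : PR (suc n)) (xs : Vec ℕ n) : ℕ → ℕ → Set where
    stop : ∀ {y} → f [ y ∷ xs ]⇓ 0 → Search f xs y y
    next : ∀ {y r z} → f [ y ∷ xs ]⇓ suc r → Search f xs (suc y) z → Search f xs y z

-- Agreement of fuelled evaluation with the big-step semantics

>>=-just : ∀ {A B : Set} (a : Maybe A) {f : A → Maybe B} {b} →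
           (a >>= f) ≡ just b → ∃ λ x → a ≡ just x × f x ≡ just b
>>=-just (just x) eq = x , refl , eq

mutual
  eval⇒⇓ : ∀ k (c : PR n) xs {y} → eval k c xs ≡ just y → c [ xs ]⇓ y
  eval⇒⇓ (suc k) zer xs refl = zer⇓
  eval⇒⇓ (suc k) succ (x ∷ []) refl = succ⇓
  eval⇒⇓ (suc k) (proj i) xs refl = proj⇓
  eval⇒⇓ (suc k) (comp f gs) xs eq with >>=-just (evalVec k gs xs) eq
  ... | ys , eq₁ , eq₂ = comp⇓ (evalVec⇒⇓ k gs xs eq₁) (eval⇒⇓ k f ys eq₂)
  eval⇒⇓ (suc k) (prec f g) (zero ∷ xs) eq = prec₀⇓ (eval⇒⇓ k f xs eq)
  eval⇒⇓ (suc k) (prec f g) (suc i ∷ xs) eq with >>=-just (eval k (prec f g) (i ∷ xs)) eq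
  ... | r , eq₁ , eq₂ = precₛ⇓ (eval⇒⇓ k (prec f g) (i ∷ xs) eq₁) (eval⇒⇓ k g (i ∷ r ∷ xs) eq₂)
  eval⇒⇓ (suc k) (mu f) xs eq = mu⇓ (search⇒⇓ k f xs 0 eq)

  evalVec⇒⇓ : ∀ k (gs : Vec (PR n) m) xs {ys} → evalVec k gs xs ≡ just ys → gs [ xs ]⇓* ys
  evalVec⇒⇓ k [] xs refl = []⇓
  evalVec⇒⇓ k (g ∷ gs) xs eq with >>=-just (eval k g xs) eq
  ... | y , eq₁ , eq₂ with >>=-just (evalVec k gs xs) eq₂
  ... | ys , eq₃ , refl = eval⇒⇓ k g xs eq₁ ∷⇓ evalVec⇒⇓ k gs xs eq₃

  search⇒⇓ : ∀ k (f : PR (suc n)) xs y {z} → search k f xs y ≡ just z → Search f xs y z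
  search⇒⇓ (suc k) f xs y eq with >>=-just (eval k f (y ∷ xs)) eq
  ... | zero  , eq₁ , refl = stop (eval⇒⇓ k f (y ∷ xs) eq₁)
  ... | suc r , eq₁ , eq₂ = next (eval⇒⇓ k f (y ∷ xs) eq₁) (search⇒⇓ k f xs (suc y) eq₂)

-- Asking for all large fuels instead of one builds in monotonicity, so subderivations can be
-- combined at a common fuel.
Eventually : (ℕ → Set) → Set
Eventually P = ∃ λ k₀ → ∀ k → k₀ ≤ k → P k

eventually-pos : ∀ {P : ℕ → Set} → Eventually (P ∘ suc) → Eventually P
eventually-pos (k₀ , p) = suc k₀ , λ { (suc k) (s≤s k₀≤k) → p k k₀≤k }

eventually-map₂ : ∀ {P Q R : ℕ → Set} → (∀ k → P k → Q k → R k) →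
                  Eventually P → Eventually Q → Eventually R
eventually-map₂ f (k₁ , p) (k₂ , q) = k₁ ⊔ k₂ , λ k le →
  f k (p k (≤-trans (m≤m⊔n k₁ k₂) le)) (q k (≤-trans (m≤n⊔m k₁ k₂) le))

eventually-map : ∀ {P Q : ℕ → Set} → (∀ k → P k → Q k) → Eventually P → Eventually Q
eventually-map f (k₀ , p) = k₀ , λ k le → f k (p k le)

mutual
  ⇓⇒eval : ∀ {c : PR n} {xs y} → c [ xs ]⇓ y → Eventually λ k → eval k c xs ≡ just y
  ⇓⇒eval zer⇓  = 1 , λ { (suc k) _ → refl }
  ⇓⇒eval succ⇓ = 1 , λ { (suc k) _ → refl }
  ⇓⇒eval proj⇓ = 1 , λ { (suc k) _ → refl }
  ⇓⇒eval (comp⇓ {f = f} ds d) = eventually-pos (eventually-map₂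
    (λ k eqs eq → trans (cong (_>>= eval k f) eqs) eq) (⇓*⇒evalVec ds) (⇓⇒eval d))
  ⇓⇒eval (prec₀⇓ d) = eventually-pos (⇓⇒eval d)
  ⇓⇒eval (precₛ⇓ d₁ d₂) = eventually-pos (eventually-map₂
    (λ k eq₁ eq₂ → trans (cong (_>>= _) eq₁) eq₂) (⇓⇒eval d₁) (⇓⇒eval d₂))
  ⇓⇒eval (mu⇓ d) = eventually-pos (Search⇒search d)

  ⇓*⇒evalVec : ∀ {gs : Vec (PR n) m} {xs ys} → gs [ xs ]⇓* ys →
               Eventually λ k → evalVec k gs xs ≡ just ys
  ⇓*⇒evalVec []⇓ = 0 , λ _ _ → refl
  ⇓*⇒evalVec (d ∷⇓ ds) = eventually-map₂
    (λ k eq eqs → trans (cong (_>>= _) eq) (cong (_>>= _) eqs)) (⇓⇒eval d) (⇓*⇒evalVec ds)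

  Search⇒search : ∀ {f : PR (suc n)} {xs y z} → Search f xs y z →
                  Eventually λ k → search k f xs y ≡ just z
  Search⇒search {f = f} {xs} {y} (stop d) = eventually-pos (eventually-map
    (λ k eq → cong (_>>= searchStep k f xs y) eq) (⇓⇒eval d))
  Search⇒search {f = f} {xs} {y} (next d s) = eventually-pos (eventually-map₂
    (λ k eq eq′ → trans (cong (_>>= searchStep k f xs y) eq) eq′) (⇓⇒eval d) (Search⇒search s))

⇓-eval : ∀ {c : PR n} {xs y} → c [ xs ]⇓ y → ∃ λ k → eval k c xs ≡ just y
⇓-eval d with ⇓⇒eval d
... | k₀ , eq = k₀ , eq k₀ ≤-refl

-- Both derivations are evaluated with one fuel that is large enough for each, and `eval` is a
-- function.
⇓-deterministic : ∀ {c : PR n} {xs y z} → c [ xs ]⇓ y → c [ xs ]⇓ z → y ≡ z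
⇓-deterministic d d′ with eventually-map₂ (λ k eq eq′ → just-injective (trans (sym eq) eq′))
                            (⇓⇒eval d) (⇓⇒eval d′)
... | k₀ , eq = eq k₀ ≤-refl

-- Total programs together with the function they compute

record Fn (n : ℕ) : Set where
  field
    prog : PR n
    sem  : Vec ℕ n → ℕ
    runs : ∀ xs → prog [ xs ]⇓ sem xs
open Fn public

total⇒Fn : ∀ (c : PR n) → Total c → Fn n
total⇒Fn c tot = record
  { prog = c
  ; sem  = λ xs → proj₁ (proj₂ (tot xs))
  ; runs = λ xs → eval⇒⇓ (proj₁ (tot xs)) c xs (proj₂ (proj₂ (tot xs))) }

Fn-total : (F : Fn n) → Total (prog F)
Fn-total F xs with ⇓-eval (runs F xs)
... | k , eq = k , sem F xs , eq

Holds⇔sem : ∀ (F : Fn n) xs → Holds (prog F) xs ⇔ sem F xs ≡ 0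
Holds⇔sem F xs = mk⇔
  (λ { (k , eq) → ⇓-deterministic (runs F xs) (eval⇒⇓ k (prog F) xs eq) })
  (λ eq → ⇓-eval (subst (prog F [ xs ]⇓_) eq (runs F xs)))

-- Installs the intended expression as the value of `sem`, so that later identities hold by
-- computation.
refine : (F : Fn n) (f : Vec ℕ n → ℕ) → (∀ xs → sem F xs ≡ f xs) → Fn n
refine F f eq = record
  { prog = prog F ; sem = f ; runs = λ xs → subst (prog F [ xs ]⇓_) (eq xs) (runs F xs) }

-- Arithmetic by primitive recursion

var : Fin n → Fn n
var i = record { prog = proj i ; sem = λ xs → lookup xs i ; runs = λ _ → proj⇓ }

sems : Vec (Fn n) m → Vec ℕ n → Vec ℕ m
sems []       xs = []
sems (G ∷ Gs) xs = sem G xs ∷ sems Gs xs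

progs : Vec (Fn n) m → Vec (PR n) m
progs []       = []
progs (G ∷ Gs) = prog G ∷ progs Gs

runs* : (Gs : Vec (Fn n) m) → ∀ xs → progs Gs [ xs ]⇓* sems Gs xs
runs* []       xs = []⇓
runs* (G ∷ Gs) xs = runs G xs ∷⇓ runs* Gs xs

app : Fn m → Vec (Fn n) m → Fn n
app F Gs = record
  { prog = comp (prog F) (progs Gs)
  ; sem  = λ xs → sem F (sems Gs xs)
  ; runs = λ xs → comp⇓ (runs* Gs xs) (runs F (sems Gs xs)) }

app₁ : Fn 1 → Fn n → Fn n
app₁ F G = app F (G ∷ [])

app₂ : Fn 2 → Fn n → Fn n → Fn n
app₂ F G H = app F (G ∷ H ∷ [])

constPR : ℕ → PR n
constPR zero    = zer
constPR (suc k) = comp succ (constPR k ∷ [])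

constPR⇓ : ∀ k {xs : Vec ℕ n} → constPR k [ xs ]⇓ k
constPR⇓ zero    = zer⇓
constPR⇓ (suc k) = comp⇓ (constPR⇓ k ∷⇓ []⇓) succ⇓

cst : ℕ → Fn n
cst k = record { prog = constPR k ; sem = λ _ → k ; runs = λ _ → constPR⇓ k }

sucF : Fn n → Fn n
sucF F = record
  { prog = comp succ (prog F ∷ []) ; sem = λ xs → suc (sem F xs)
  ; runs = λ xs → comp⇓ (runs F xs ∷⇓ []⇓) succ⇓ }

recurse : {A : Set} → A → (ℕ → A → A) → ℕ → A
recurse z s zero    = z
recurse z s (suc i) = s i (recurse z s i)

precF : Fn n → Fn (2 + n) → Fn (suc n)
precF F G = record
  { prog = prec (prog F) (prog G)
  ; sem  = λ { (i ∷ xs) → recurse (sem F xs) (λ i r → sem G (i ∷ r ∷ xs)) i }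
  ; runs = λ { (i ∷ xs) → go i xs } }
  where
  go : ∀ i xs → prec (prog F) (prog G) [ i ∷ xs ]⇓
                  recurse (sem F xs) (λ i r → sem G (i ∷ r ∷ xs)) i
  go zero    xs = prec₀⇓ (runs F xs)
  go (suc i) xs = precₛ⇓ (go i xs) (runs G _)

ifz : ℕ → ℕ → ℕ → ℕ
ifz zero    a b = a
ifz (suc _) a b = b

ifzF : Fn n → Fn n → Fn n → Fn n
ifzF C F G = refine (app (precF (var 0F) (var 3F)) (C ∷ F ∷ G ∷ []))
  (λ xs → ifz (sem C xs) (sem F xs) (sem G xs)) (λ xs → eq (sem C xs))
  where
  eq : ∀ c {a b : ℕ} → recurse a (λ _ _ → b) c ≡ ifz c a b
  eq zero    = refl
  eq (suc c) = refl

op₂ : (F : Fn 2) (f : ℕ → ℕ → ℕ) → (∀ x y → sem F (x ∷ y ∷ []) ≡ f x y) →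
      Fn n → Fn n → Fn n
op₂ F f eq G H = refine (app₂ F G H) (λ xs → f (sem G xs) (sem H xs)) (λ xs → eq _ _)

op₁ : (F : Fn 1) (f : ℕ → ℕ) → (∀ x → sem F (x ∷ []) ≡ f x) → Fn n → Fn n
op₁ F f eq G = refine (app₁ F G) (λ xs → f (sem G xs)) (λ xs → eq _)

predF : Fn n → Fn n
predF = op₁ (precF (cst 0) (var 0F)) pred λ { zero → refl ; (suc x) → refl }

infixl 6 _+F_ _∸F_
infixl 7 _*F_

_+F_ _*F_ _∸F_ pairF : Fn n → Fn n → Fn n

_+F_ = op₂ (precF (var 0F) (sucF (var 1F))) _+_ eq
  where
  eq : ∀ x y → recurse y (λ _ → suc) x ≡ x + y
  eq zero    y = refl
  eq (suc x) y = cong suc (eq x y)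

_*F_ = op₂ (precF (cst 0) (var 2F +F var 1F)) _*_ eq
  where
  eq : ∀ x y → recurse 0 (λ _ → y +_) x ≡ x * y
  eq zero    y = refl
  eq (suc x) y = cong (y +_) (eq x y)

_∸F_ = op₂ (app₂ (precF (var 0F) (predF (var 1F))) (var 1F) (var 0F)) _∸_ eq
  where
  eq : ∀ x y → recurse x (λ _ → pred) y ≡ x ∸ y
  eq x zero    = refl
  eq x (suc y) = trans (cong pred (eq x y)) (pred[m∸n]≡m∸[1+n] x y)

triF : Fn n → Fn n
triF = op₁ (precF (cst 0) (sucF (var 0F) +F var 1F)) tri eq
  where
  eq : ∀ x → recurse 0 (λ i r → suc i + r) x ≡ tri x
  eq zero    = refl
  eq (suc x) = cong (suc x +_) (eq x)

pairF = op₂ (triF (var 0F +F var 1F) +F var 1F) ⟪_,_⟫ (λ x y → sym (⟪⟫≡pair x y))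

-- The index π₁ z + π₂ z of the antidiagonal of z increases exactly at triangular numbers.
diag : ℕ → ℕ
diag = recurse 0 λ z d → ifz (tri (suc d) ∸ suc z) (suc d) d

diag≡ : ∀ z → diag z ≡ π₁ z + π₂ z
diag≡ zero = refl
diag≡ (suc z) rewrite diag≡ z with unpair z | pair-unpair z
... | zero  , y | refl rewrite +-comm y (tri y) | n∸n≡0 (tri y + y) = sym (+-identityʳ (suc y))
... | suc x , y | refl = trans (cong (λ t → ifz t (suc (suc x + y)) (suc x + y)) eq) (sym (+-suc x y))
  where
  s = suc x + y
  -- The distance from the successor of z to the next triangular number is positive, so the
  -- antidiagonal does not change.
  eq : (suc s + tri s) ∸ suc (tri s + y) ≡ suc x
  eq = begin
    (s + tri s) ∸ (tri s + y)   ≡⟨ cong (_∸ (tri s + y)) (+-comm s (tri s)) ⟩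
    (tri s + s) ∸ (tri s + y)   ≡⟨ [m+n]∸[m+o]≡n∸o (tri s) s y ⟩
    (suc x + y) ∸ y             ≡⟨ m+n∸n≡m (suc x) y ⟩
    suc x                       ∎
    where open ≡-Reasoning

diagF : Fn n → Fn n
diagF = op₁ (precF (cst 0) (ifzF (triF (sucF (var 1F)) ∸F sucF (var 0F)) (sucF (var 1F)) (var 1F)))
  diag (λ _ → refl)

π₁F π₂F : Fn n → Fn n

π₂F = op₁ (var 0F ∸F triF (diagF (var 0F))) π₂ eq
  where
  eq : ∀ z → z ∸ tri (diag z) ≡ π₂ z
  eq z = begin
    z ∸ tri (diag z)                               ≡⟨ cong₂ (λ a d → a ∸ tri d) (sym (pair-unpair z)) (diag≡ z) ⟩
    pair (π₁ z) (π₂ z) ∸ tri (π₁ z + π₂ z)         ≡⟨ m+n∸m≡n (tri (π₁ z + π₂ z)) (π₂ z) ⟩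
    π₂ z                                           ∎
    where open ≡-Reasoning

π₁F = op₁ (diagF (var 0F) ∸F π₂F (var 0F)) π₁
  (λ z → trans (cong (_∸ π₂ z) (diag≡ z)) (m+n∸n≡m (π₁ z) (π₂ z)))

nthF : Fn n → Fn n → Fn n
nthF = op₂ (π₁F (app₂ (precF (var 0F) (π₂F (var 1F))) (var 1F) (var 0F))) nth eq
  where
  tail : ℕ → ℕ → ℕ
  tail σ = recurse σ λ _ → π₂
  -- `nth` applies `π₂` before recursing, primitive recursion applies it afterwards; the two orders
  -- agree.
  tail-π₂ : ∀ σ i → tail (π₂ σ) i ≡ π₂ (tail σ i)
  tail-π₂ σ zero    = refl
  tail-π₂ σ (suc i) = cong π₂ (tail-π₂ σ i)
  eq : ∀ σ i → π₁ (tail σ i) ≡ nth σ i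
  eq σ zero    = refl
  eq σ (suc i) = trans (cong π₁ (sym (tail-π₂ σ i))) (eq (π₂ σ) i)

-- Connectives and bounded quantifiers; as in Holds, a value counts as true when it is 0.

eqN : ℕ → ℕ → ℕ
eqN x y = (x ∸ y) + (y ∸ x)

eqN-sound : ∀ x y → eqN x y ≡ 0 → x ≡ y
eqN-sound x y eq = ≤-antisym (m∸n≡0⇒m≤n (m+n≡0⇒m≡0 (x ∸ y) eq)) (m∸n≡0⇒m≤n (m+n≡0⇒n≡0 (x ∸ y) eq))

eqN-complete : ∀ x → eqN x x ≡ 0
eqN-complete x rewrite n∸n≡0 x = refl

eqF : Fn n → Fn n → Fn n
eqF F G = (F ∸F G) +F (G ∸F F)

not : ℕ → ℕ
not x = ifz x 1 0

notF : Fn n → Fn n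
notF F = ifzF F (cst 1) (cst 0)

-- A sum vanishes iff all its terms do, a product iff some factor does; the empty product 1 is
-- false.
all< ex< : ℕ → (ℕ → ℕ) → ℕ
all< n f = recurse 0 (λ i r → r + f i) n
ex<  n f = recurse 1 (λ i r → r * f i) n

all<-sound : ∀ n f → all< n f ≡ 0 → ∀ i → i < n → f i ≡ 0
all<-sound (suc n) f eq i i<1+n with m<1+n⇒m<n∨m≡n i<1+n
... | inj₁ i<n  = all<-sound n f (m+n≡0⇒m≡0 (all< n f) eq) i i<n
... | inj₂ refl = m+n≡0⇒n≡0 (all< n f) eq

all<-complete : ∀ n f → (∀ i → i < n → f i ≡ 0) → all< n f ≡ 0
all<-complete zero    f p = refl
all<-complete (suc n) f p =
  cong₂ _+_ (all<-complete n f λ i i<n → p i (m<n⇒m<1+n i<n)) (p n (n<1+n n))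

ex<-sound : ∀ n f → ex< n f ≡ 0 → ∃ λ i → i < n × f i ≡ 0
ex<-sound (suc n) f eq with m*n≡0⇒m≡0∨n≡0 (ex< n f) eq
... | inj₁ e with ex<-sound n f e
...   | i , i<n , p = i , m<n⇒m<1+n i<n , p
ex<-sound (suc n) f eq | inj₂ p = n , n<1+n n , p

ex<-complete : ∀ n f i → i < n → f i ≡ 0 → ex< n f ≡ 0
ex<-complete (suc n) f i i<1+n p with m<1+n⇒m<n∨m≡n i<1+n
... | inj₁ i<n  = cong (_* f n) (ex<-complete n f i i<n p)
... | inj₂ refl = trans (cong (ex< n f *_) p) (*-zeroʳ (ex< n f))

vars : (Fin m → Fin n) → Vec (Fn n) m
vars ρ = tabulate (var ∘ ρ)

sems-vars : ∀ (ρ : Fin m → Fin n) xs → sems (vars ρ) xs ≡ tabulate (lookup xs ∘ ρ)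
sems-vars {zero}  ρ xs = refl
sems-vars {suc m} ρ xs = cong (lookup xs (ρ 0F) ∷_) (sems-vars (ρ ∘ Fin.suc) xs)

-- Common scheme of the bounded sum and product: `s` combines the value so far with the next one,
-- starting from `z`.
bounded : (s : ℕ → ℕ → ℕ) (S : Fn 2) → (∀ r x → sem S (r ∷ x ∷ []) ≡ s r x) → ℕ →
          Fn n → Fn (suc n) → Fn n
bounded s S eqS z B P = refine
  -- The step receives index, accumulator and parameters; the double shift hides the accumulator
  -- from `P`. The parameters are passed a second time, since the bound occupies the recursion
  -- argument.
  (app (precF (cst z) (app₂ S (var 1F) (app P (var 0F ∷ vars (Fin.suc ∘ Fin.suc))))) (B ∷ vars (λ i → i)))
  (λ xs → recurse z (λ i r → s r (sem P (i ∷ xs))) (sem B xs))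
  (λ xs → trans (cong (λ ys → recurse z (λ i r → sem S (r ∷ sem P (i ∷ sems (vars (Fin.suc ∘ Fin.suc)) (i ∷ r ∷ ys)) ∷ []))
                                 (sem B xs))
                      (trans (sems-vars _ xs) (tabulate∘lookup xs)))
                (eq xs (sem B xs)))
  where
  eq : ∀ xs k → recurse z (λ i r → sem S (r ∷ sem P (i ∷ sems (vars (Fin.suc ∘ Fin.suc)) (i ∷ r ∷ xs)) ∷ [])) k
              ≡ recurse z (λ i r → s r (sem P (i ∷ xs))) k
  eq xs zero = refl
  eq xs (suc k) = trans (eqS _ _) (cong₂ s (eq xs k)
    (cong (λ ys → sem P (k ∷ ys)) (trans (sems-vars _ _) (tabulate∘lookup xs))))

all<F ex<F : Fn n → Fn (suc n) → Fn n
all<F = bounded _+_ (var 0F +F var 1F) (λ _ _ → refl) 0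
ex<F  = bounded _*_ (var 0F *F var 1F) (λ _ _ → refl) 1

-- Gödel numbers

mutual
  encode : PR n → ℕ
  encode zer               = 0
  encode succ              = ⟪ 1 , 0 ⟫
  encode (proj i)          = ⟪ 2 , toℕ i ⟫
  encode (comp {m} f gs)   = ⟪ 3 , ⟪ m , ⟪ encode f , encodeVec gs ⟫ ⟫ ⟫
  encode (prec f g)        = ⟪ 4 , ⟪ encode f , encode g ⟫ ⟫
  encode (mu f)            = ⟪ 5 , encode f ⟫

  encodeVec : Vec (PR n) m → ℕ
  encodeVec []       = 0
  encodeVec (g ∷ gs) = ⟪ encode g , encodeVec gs ⟫

clampFin-toℕ : ∀ (i : Fin (suc n)) → clampFin n (toℕ i) ≡ i
clampFin-toℕ {n}     Fin.zero    = refl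
clampFin-toℕ {suc n} (Fin.suc i) = cong Fin.suc (clampFin-toℕ i)

-- The clauses of `decodeTag` also split on the arity, so a tag alone does not make it compute.
decodeTag-comp : ∀ k n a → decodeTag k n (3 , a) ≡ decodeComp k n (unpair a)
decodeTag-comp k zero          a = refl
decodeTag-comp k (suc zero)    a = refl
decodeTag-comp k (suc (suc n)) a = refl

decodeTag-mu : ∀ k n a → decodeTag k n (5 , a) ≡ mu (decode k (suc n) a)
decodeTag-mu k zero          a = refl
decodeTag-mu k (suc zero)    a = refl
decodeTag-mu k (suc (suc n)) a = refl

decodeTag-prec : ∀ k n a → decodeTag k (suc n) (4 , a) ≡ decodePrec k n (unpair a)
decodeTag-prec k zero    a = refl
decodeTag-prec k (suc n) a = refl

decodeTag-proj : ∀ k n a → decodeTag k (suc n) (2 , a) ≡ proj (clampFin n a)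
decodeTag-proj k zero    a = refl
decodeTag-proj k (suc n) a = refl

mutual
  -- A payload lies strictly below its pair with a nonzero tag, so after one unit of fuel is spent
  -- the rest still exceeds the codes of all subprograms.
  decode-encode : ∀ k (c : PR n) → encode c < k → decode k n (encode c) ≡ c
  decode-encode (suc k) zer lt = refl
  decode-encode (suc k) succ lt = cong (decodeTag k 1) (unpair-⟪⟫ 1 0)
  decode-encode {suc n} (suc k) (proj i) lt =
    trans (cong (decodeTag k (suc n)) (unpair-⟪⟫ 2 (toℕ i)))
   (trans (decodeTag-proj k n (toℕ i)) (cong proj (clampFin-toℕ i)))
  decode-encode {n} (suc k) (comp {m} f gs) lt = begin
    decodeTag k n (unpair ⟪ 3 , a ⟫)     ≡⟨ cong (decodeTag k n) (unpair-⟪⟫ 3 a) ⟩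
    decodeTag k n (3 , a)                 ≡⟨ decodeTag-comp k n a ⟩
    decodeComp k n (unpair ⟪ m , r ⟫)    ≡⟨ cong (decodeComp k n) (unpair-⟪⟫ m r) ⟩
    decodeComp′ k n m (unpair r)          ≡⟨ cong (decodeComp′ k n m) (unpair-⟪⟫ (encode f) (encodeVec gs)) ⟩
    comp (decode k m (encode f)) (decodeVec k m n (encodeVec gs))
      ≡⟨ cong₂ comp (decode-encode k f (≤-<-trans (m≤⟪m,n⟫ (encode f) (encodeVec gs)) r<k))
                    (decodeVec-encodeVec k gs (≤-<-trans (n≤⟪m,n⟫ (encode f) (encodeVec gs)) r<k)) ⟩
    comp f gs                             ∎
    where
    open ≡-Reasoning
    r = ⟪ encode f , encodeVec gs ⟫
    a = ⟪ m , r ⟫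
    r<k : r < k
    r<k = ≤-<-trans (n≤⟪m,n⟫ m r) (<-≤-trans (n<⟪1+m,n⟫ 2 a) (s≤s⁻¹ lt))
  decode-encode {suc n} (suc k) (prec f g) lt = begin
    decodeTag k (suc n) (unpair ⟪ 4 , a ⟫)   ≡⟨ cong (decodeTag k (suc n)) (unpair-⟪⟫ 4 a) ⟩
    decodeTag k (suc n) (4 , a)               ≡⟨ decodeTag-prec k n a ⟩
    decodePrec k n (unpair a)                 ≡⟨ cong (decodePrec k n) (unpair-⟪⟫ (encode f) (encode g)) ⟩
    prec (decode k n (encode f)) (decode k (2 + n) (encode g))
      ≡⟨ cong₂ prec (decode-encode k f (≤-<-trans (m≤⟪m,n⟫ (encode f) (encode g)) a<k))
                    (decode-encode k g (≤-<-trans (n≤⟪m,n⟫ (encode f) (encode g)) a<k)) ⟩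
    prec f g                                  ∎
    where
    open ≡-Reasoning
    a = ⟪ encode f , encode g ⟫
    a<k : a < k
    a<k = <-≤-trans (n<⟪1+m,n⟫ 3 a) (s≤s⁻¹ lt)
  decode-encode {n} (suc k) (mu f) lt = begin
    decodeTag k n (unpair ⟪ 5 , encode f ⟫)   ≡⟨ cong (decodeTag k n) (unpair-⟪⟫ 5 (encode f)) ⟩
    decodeTag k n (5 , encode f)                 ≡⟨ decodeTag-mu k n (encode f) ⟩
    mu (decode k (suc n) (encode f))
      ≡⟨ cong mu (decode-encode k f (<-≤-trans (n<⟪1+m,n⟫ 4 (encode f)) (s≤s⁻¹ lt))) ⟩
    mu f                                         ∎
    where open ≡-Reasoning

  decodeVec-encodeVec : ∀ k (gs : Vec (PR n) m) → encodeVec gs < k →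
                        decodeVec k m n (encodeVec gs) ≡ gs
  decodeVec-encodeVec k [] lt = refl
  decodeVec-encodeVec {n} {suc m} k (g ∷ gs) lt =
    trans (cong (decodeVecStep k m n) (unpair-⟪⟫ (encode g) (encodeVec gs)))
          (cong₂ _∷_ (decode-encode k g (≤-<-trans (m≤⟪m,n⟫ (encode g) (encodeVec gs)) lt))
                     (decodeVec-encodeVec k gs (≤-<-trans (n≤⟪m,n⟫ (encode g) (encodeVec gs)) lt)))

code-encode : ∀ (c : PR n) → code n (encode c) ≡ c
code-encode c = decode-encode (suc (encode c)) c ≤-refl

W⇔⇓ : ∀ e x → W e x ⇔ ∃ λ y → code 1 e [ x ∷ [] ]⇓ y
W⇔⇓ e x = mk⇔
  (λ { (k , y , eq) → y , eval⇒⇓ k (code 1 e) (x ∷ []) eq })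
  (λ { (y , d) → proj₁ (⇓-eval d) , y , proj₂ (⇓-eval d) })

-- The s-m-n theorem for a search over a total program

module Enumeration (A : Fn 3) where

  specialise : ℕ → PR 1
  specialise x = comp (mu (prog A)) (constPR x ∷ proj 0F ∷ [])

  smn : ℕ → ℕ
  smn x = encode (specialise x)

  smn-recursive : Recursive smn
  smn-recursive = prog indexF , λ x → ⇓-eval (subst (prog indexF [ x ∷ [] ]⇓_) (index≡ x) (runs indexF (x ∷ [])))
    where
    -- The numeral program for x is an x-fold composition with `succ`, so its code is found by
    -- recursion on x.
    constF : Fn 1
    constF = precF (cst 0)
      (pairF (cst 3) (pairF (cst 1) (pairF (cst ⟪ 1 , 0 ⟫) (pairF (var 1F) (cst 0)))))

    indexF : Fn 1
    indexF = pairF (cst 3) (pairF (cst 2) (pairF (cst (encode (mu (prog A))))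
      (pairF constF (cst (encodeVec (proj {1} 0F ∷ []))))))

    const≡ : ∀ x → sem constF (x ∷ []) ≡ encode (constPR {1} x)
    const≡ zero    = refl
    const≡ (suc x) = cong (λ c → ⟪ 3 , ⟪ 1 , ⟪ ⟪ 1 , 0 ⟫ , ⟪ c , 0 ⟫ ⟫ ⟫ ⟫) (const≡ x)

    index≡ : ∀ x → sem indexF (x ∷ []) ≡ smn x
    index≡ x = cong (λ c → ⟪ 3 , ⟪ 2 , ⟪ encode (mu (prog A)) , ⟪ c , encodeVec (proj {1} 0F ∷ []) ⟫ ⟫ ⟫ ⟫)
                    (const≡ x)

  Search⇒zero : ∀ {x z y w} → Search (prog A) (x ∷ z ∷ []) y w → sem A (w ∷ x ∷ z ∷ []) ≡ 0
  Search⇒zero (stop d)   = ⇓-deterministic (runs A _) d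
  Search⇒zero (next _ s) = Search⇒zero s

  -- Induction on the distance d to a known zero. The search may stop earlier, at a smaller zero, so
  -- its result is left existential.
  zero⇒Search : ∀ {x z} d y → sem A (d + y ∷ x ∷ z ∷ []) ≡ 0 → ∃ λ w → Search (prog A) (x ∷ z ∷ []) y w
  zero⇒Search {x} {z} d y eq with sem A (y ∷ x ∷ z ∷ []) | runs A (y ∷ x ∷ z ∷ [])
  zero⇒Search d y eq | zero | r = y , stop r
  zero⇒Search {x} {z} zero y eq | suc v | r
    with () ← ⇓-deterministic r (subst (prog A [ y ∷ x ∷ z ∷ [] ]⇓_) eq (runs A (y ∷ x ∷ z ∷ [])))
  zero⇒Search {x} {z} (suc d) y eq | suc v | r
    with zero⇒Search d (suc y) (trans (cong (λ w → sem A (w ∷ x ∷ z ∷ [])) (+-suc d y)) eq)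
  ... | w , s = w , next r s

  W-smn : ∀ x z → W (smn x) z ⇔ ∃ λ w → sem A (w ∷ x ∷ z ∷ []) ≡ 0
  W-smn x z = mk⇔ ⇒ ⇐
    where
    ⇒ : W (smn x) z → ∃ λ w → sem A (w ∷ x ∷ z ∷ []) ≡ 0
    ⇒ p with to (W⇔⇓ (smn x) z) p
    ... | y , d with subst (_[ z ∷ [] ]⇓ y) (code-encode (specialise x)) d
    ... | comp⇓ (c ∷⇓ proj⇓ ∷⇓ []⇓) (mu⇓ s) with ⇓-deterministic c (constPR⇓ x)
    ... | refl = y , Search⇒zero s
    ⇐ : (∃ λ w → sem A (w ∷ x ∷ z ∷ []) ≡ 0) → W (smn x) z
    ⇐ (w , eq) with zero⇒Search w 0 (subst (λ v → sem A (v ∷ x ∷ z ∷ []) ≡ 0) (sym (+-identityʳ w)) eq)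
    ... | y , s = from (W⇔⇓ (smn x) z) (y , subst (_[ z ∷ [] ]⇓ y) (sym (code-encode (specialise x)))
                             (comp⇓ (constPR⇓ x ∷⇓ (proj⇓ ∷⇓ []⇓)) (mu⇓ s)))

-- An abstract machine evaluating Gödel numbers

decodeArgs : ∀ n → ℕ → Vec ℕ n
decodeArgs zero    v = []
decodeArgs (suc n) v = π₁ v ∷ decodeArgs n (π₂ v)

encodeArgs : Vec ℕ n → ℕ
encodeArgs []       = 0
encodeArgs (x ∷ xs) = ⟪ x , encodeArgs xs ⟫

decodeArgs-⟪⟫ : ∀ x v → decodeArgs (suc n) ⟪ x , v ⟫ ≡ x ∷ decodeArgs n v
decodeArgs-⟪⟫ {n} x v = cong₂ (λ y w → y ∷ decodeArgs n w) (π₁-⟪⟫ x v) (π₂-⟪⟫ x v)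

decodeArgs-encodeArgs : ∀ (xs : Vec ℕ n) → decodeArgs n (encodeArgs xs) ≡ xs
decodeArgs-encodeArgs []       = refl
decodeArgs-encodeArgs (x ∷ xs) =
  trans (decodeArgs-⟪⟫ x (encodeArgs xs)) (cong (x ∷_) (decodeArgs-encodeArgs xs))

-- `ifz (a ∸ n) a n` is the minimum of a and n, the index to which `clampFin` clamps.
lookup-clampFin : ∀ n v a → lookup (decodeArgs (suc n) v) (clampFin n a) ≡ nth v (ifz (a ∸ n) a n)
lookup-clampFin n       v zero    rewrite 0∸n≡0 n = refl
lookup-clampFin zero    v (suc a) = refl
lookup-clampFin (suc n) v (suc a) = trans (lookup-clampFin n (π₂ v) a) (eq (a ∸ n))
  where
  eq : ∀ c → nth (π₂ v) (ifz c a n) ≡ nth v (ifz c (suc a) (suc n))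
  eq zero    = refl
  eq (suc c) = refl

-- In every frame k is the fuel that decode still has at the code in question.
data Frame : Set where
  EVAL  : (k n e v : ℕ) → Frame
  EVALS : (k m n c v : ℕ) → Frame
  TAIL  : (k m n c v : ℕ) → Frame
  CONS  : (y : ℕ) → Frame
  CALL  : (k m f : ℕ) → Frame
  REC   : (k n g i v : ℕ) → Frame
  MU    : (k n f v y : ℕ) → Frame

-- The number is the value just returned to the top frame; `EVAL` and `EVALS` begin a computation
-- and ignore it.
State : Set
State = ℕ × List Frame

stepPrec : (k n e v i : ℕ) → List Frame → State
stepPrec k zero    e v i       K = 0 , K
stepPrec k (suc n) e v zero    K = 0 , EVAL k n (π₁ (π₂ e)) (π₂ v) ∷ K
-- The value at i comes from the same code `e`, so the unit of fuel spent on reading its tag is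
-- restored.
stepPrec k (suc n) e v (suc i) K =
  0 , EVAL (suc k) (suc n) e ⟪ i , π₂ v ⟫ ∷ REC k (2 + n) (π₂ (π₂ e)) i (π₂ v) ∷ K

stepSucc : (n v : ℕ) → List Frame → State
stepSucc (suc zero) v K = suc (π₁ v) , K
stepSucc _          v K = 0 , K

stepProj : (n v a : ℕ) → List Frame → State
stepProj zero    v a K = 0 , K
stepProj (suc n) v a K = nth v (ifz (a ∸ n) a n) , K

stepTag : (k n e v t : ℕ) → List Frame → State
stepTag k n e v 0 K = 0 , K
stepTag k n e v 1 K = stepSucc n v K
stepTag k n e v 2 K = stepProj n v (π₂ e) K
stepTag k n e v 3 K =
  0 , EVALS k (π₁ (π₂ e)) n (π₂ (π₂ (π₂ e))) v ∷ CALL k (π₁ (π₂ e)) (π₁ (π₂ (π₂ e))) ∷ K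
stepTag k n e v 4 K = stepPrec k n e v (π₁ v) K
stepTag k n e v 5 K = 0 , EVAL k (suc n) (π₂ e) ⟪ 0 , v ⟫ ∷ MU k (suc n) (π₂ e) v 0 ∷ K
stepTag k n e v (suc (suc (suc (suc (suc (suc _)))))) K = 0 , K

step : State → State
step (y , []) = y , []
step (y , EVAL zero n e v ∷ K)        = 0 , K
step (y , EVAL (suc k) n e v ∷ K)     = stepTag k n e v (π₁ e) K
step (y , EVALS k zero n c v ∷ K)     = 0 , K
step (y , EVALS k (suc m) n c v ∷ K)  = 0 , EVAL k n (π₁ c) v ∷ TAIL k m n (π₂ c) v ∷ K
step (y , TAIL k m n c v ∷ K)         = 0 , EVALS k m n c v ∷ CONS y ∷ K
step (y , CONS x ∷ K)                 = ⟪ x , y ⟫ , K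
step (y , CALL k m f ∷ K)             = 0 , EVAL k m f y ∷ K
step (y , REC k n g i v ∷ K)          = 0 , EVAL k n g ⟪ i , ⟪ y , v ⟫ ⟫ ∷ K
step (zero , MU k n f v y ∷ K)        = y , K
step (suc r , MU k n f v y ∷ K)       = 0 , EVAL k n f ⟪ suc y , v ⟫ ∷ MU k n f v (suc y) ∷ K

run : ℕ → State → State
run t σ = recurse σ (λ _ → step) t

-- Soundness and completeness of the machine

run-step : ∀ t σ → run t (step σ) ≡ step (run t σ)
run-step zero    σ = refl
run-step (suc t) σ = cong step (run-step t σ)

HaltsIn : ℕ → State → Set
HaltsIn t σ = proj₂ (run t σ) ≡ []

Halts : State → Set
Halts σ = ∃ λ t → HaltsIn t σ

halts-step : ∀ {σ} → Halts (step σ) → Halts σ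
halts-step {σ} (t , h) = suc t , trans (cong proj₂ (sym (run-step t σ))) h

-- A state with empty stack is a fixed point of `step`.
haltsIn-mono : ∀ {t t′} σ → t ≤′ t′ → HaltsIn t σ → HaltsIn t′ σ
haltsIn-mono σ ≤′-refl h = h
haltsIn-mono {t} σ (≤′-step {t′} le) h with run t′ σ | haltsIn-mono σ le h
... | y , [] | refl = refl

⇓-cong : ∀ {c d : PR n} {xs ys y} → c ≡ d → xs ≡ ys → c [ xs ]⇓ y → d [ ys ]⇓ y
⇓-cong refl refl d = d

-- What a stack makes of the value returned to it: invariant under step in the backward
-- direction, which gives soundness by induction on the number of steps.
⟦_⟧ : List Frame → ℕ → Set
⟦ [] ⟧ y = ⊤
⟦ EVAL k n e v ∷ K ⟧ y = ∃ λ r → decode k n e [ decodeArgs n v ]⇓ r × ⟦ K ⟧ r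
⟦ EVALS k m n c v ∷ K ⟧ y =
  ∃ λ ys → decodeVec k m n c [ decodeArgs n v ]⇓* ys × ⟦ K ⟧ (encodeArgs ys)
⟦ TAIL k m n c v ∷ K ⟧ y =
  ∃ λ ys → decodeVec k m n c [ decodeArgs n v ]⇓* ys × ⟦ K ⟧ ⟪ y , encodeArgs ys ⟫
⟦ CONS x ∷ K ⟧ y = ⟦ K ⟧ ⟪ x , y ⟫
⟦ CALL k m f ∷ K ⟧ y = ∃ λ r → decode k m f [ decodeArgs m y ]⇓ r × ⟦ K ⟧ r
⟦ REC k n g i v ∷ K ⟧ y = ∃ λ r → decode k n g [ decodeArgs n ⟪ i , ⟪ y , v ⟫ ⟫ ]⇓ r × ⟦ K ⟧ r
-- `stepTag` pushes `MU` only with positive arity; the default ⊤ makes the backward invariance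
-- trivial here.
⟦ MU k zero f v x ∷ K ⟧ y = ⊤
⟦ MU k (suc n) f v x ∷ K ⟧ zero    = ⟦ K ⟧ x
⟦ MU k (suc n) f v x ∷ K ⟧ (suc y) =
  ∃ λ z → Search (decode k (suc n) f) (decodeArgs n v) (suc x) z × ⟦ K ⟧ z

⟦_⟧ₛ : State → Set
⟦ y , K ⟧ₛ = ⟦ K ⟧ y

sound-search : ∀ k n f v x y K →
  ⟦ EVAL k (suc n) f ⟪ x , v ⟫ ∷ MU k (suc n) f v x ∷ K ⟧ y →
  ∃ λ z → Search (decode k (suc n) f) (decodeArgs n v) x z × ⟦ K ⟧ z
sound-search k n f v x y K (zero , d , s) =
  x , stop (⇓-cong refl (decodeArgs-⟪⟫ x v) d) , s
sound-search k n f v x y K (suc r , d , z , s , p) =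
  z , next (⇓-cong refl (decodeArgs-⟪⟫ x v) d) s , p

-- The recursive call evaluates `e` itself, and the hypothesis on the tag identifies it with the
-- `prec` program being analysed.
sound-prec : ∀ k n e v i K → π₁ e ≡ 4 → ⟦ stepPrec k (suc n) e v i K ⟧ₛ →
  ∃ λ r → decodePrec k n (unpair (π₂ e)) [ i ∷ decodeArgs n (π₂ v) ]⇓ r × ⟦ K ⟧ r
sound-prec k n e v zero K eq (r , d , p) = r , prec₀⇓ d , p
sound-prec k n e v (suc i) K eq (r , d , r′ , d′ , p) =
  r′ , precₛ⇓ (⇓-cong (trans (cong (λ t → decodeTag k (suc n) (t , π₂ e)) eq)
                             (decodeTag-prec k n (π₂ e)))
                      (decodeArgs-⟪⟫ i (π₂ v)) d)
              (⇓-cong refl (trans (decodeArgs-⟪⟫ i _) (cong (i ∷_) (decodeArgs-⟪⟫ r (π₂ v)))) d′)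
     , p

sound-tag : ∀ k n e v t K → π₁ e ≡ t → ⟦ stepTag k n e v t K ⟧ₛ →
  ∃ λ r → decodeTag k n (t , π₂ e) [ decodeArgs n v ]⇓ r × ⟦ K ⟧ r
sound-tag k n             e v 0 K eq p = 0 , zer⇓ , p
sound-tag k 0             e v 1 K eq p = 0 , zer⇓ , p
sound-tag k 1             e v 1 K eq p = _ , succ⇓ , p
sound-tag k (suc (suc n)) e v 1 K eq p = 0 , zer⇓ , p
sound-tag k zero          e v 2 K eq p = 0 , zer⇓ , p
sound-tag k (suc n)       e v 2 K eq p =
  _ , ⇓-cong (sym (decodeTag-proj k n (π₂ e))) refl proj⇓
    , subst ⟦ K ⟧ (sym (lookup-clampFin n v (π₂ e))) p
sound-tag k n             e v 3 K eq (ys , ds , r , d , p) =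
  r , ⇓-cong (sym (decodeTag-comp k n (π₂ e))) refl
             (comp⇓ ds (⇓-cong refl (decodeArgs-encodeArgs ys) d))
    , p
sound-tag k zero          e v 4 K eq p = 0 , zer⇓ , p
sound-tag k (suc n)       e v 4 K eq p with sound-prec k n e v (π₁ v) K eq p
... | r , d , q = r , ⇓-cong (sym (decodeTag-prec k n (π₂ e))) refl d , q
sound-tag k n             e v 5 K eq p with sound-search k n (π₂ e) v 0 0 K p
... | z , s , q = z , ⇓-cong (sym (decodeTag-mu k n (π₂ e))) refl (mu⇓ s) , q
sound-tag k zero          e v (suc (suc (suc (suc (suc (suc _)))))) K eq p = 0 , zer⇓ , p
sound-tag k (suc zero)    e v (suc (suc (suc (suc (suc (suc _)))))) K eq p = 0 , zer⇓ , p
sound-tag k (suc (suc n)) e v (suc (suc (suc (suc (suc (suc _)))))) K eq p = 0 , zer⇓ , p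

sound-step : ∀ σ → ⟦ step σ ⟧ₛ → ⟦ σ ⟧ₛ
sound-step (y , []) p = tt
sound-step (y , EVAL zero n e v ∷ K) p = 0 , zer⇓ , p
sound-step (y , EVAL (suc k) n e v ∷ K) p = sound-tag k n e v (π₁ e) K refl p
sound-step (y , EVALS k zero n c v ∷ K) p = [] , []⇓ , p
sound-step (y , EVALS k (suc m) n c v ∷ K) (r , d , ys , ds , p) = r ∷ ys , d ∷⇓ ds , p
sound-step (y , TAIL k m n c v ∷ K) p = p
sound-step (y , CONS x ∷ K) p = p
sound-step (y , CALL k m f ∷ K) p = p
sound-step (y , REC k n g i v ∷ K) p = p
sound-step (y , MU k zero f v x ∷ K) p = tt
sound-step (zero , MU k (suc n) f v x ∷ K) p = p
sound-step (suc r , MU k (suc n) f v x ∷ K) p = sound-search k n f v (suc x) 0 K p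

sound-run : ∀ t σ → ⟦ run t σ ⟧ₛ → ⟦ σ ⟧ₛ
sound-run zero    σ p = p
sound-run (suc t) σ p = sound-run t σ (sound-step (run t σ) p)

mutual
  -- Continuation style: evaluation on top of a stack halts as soon as the stack halts on the
  -- returned value, so no steps are counted. Program and arguments enter through equations so that
  -- the derivation can be matched.
  complete : ∀ k n e v {c xs r} y K → decode k n e ≡ c → decodeArgs n v ≡ xs →
             c [ xs ]⇓ r → Halts (r , K) → Halts (y , EVAL k n e v ∷ K)
  complete zero    n e v y K refl eqv zer⇓ h = halts-step h
  complete (suc k) n e v y K eqc eqv d h =
    halts-step (complete-tag k n e v (π₁ e) K refl eqc eqv d h)

  complete-tag : ∀ k n e v t {c xs r} K → π₁ e ≡ t → decodeTag k n (t , π₂ e) ≡ c →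
                 decodeArgs n v ≡ xs → c [ xs ]⇓ r → Halts (r , K) → Halts (stepTag k n e v t K)
  complete-tag k n             e v 0 K eq refl refl zer⇓ h = h
  complete-tag k 0             e v 1 K eq refl refl zer⇓ h = h
  complete-tag k 1             e v 1 K eq refl refl succ⇓ h = h
  complete-tag k (suc (suc n)) e v 1 K eq refl refl zer⇓ h = h
  complete-tag k zero          e v 2 K eq refl refl zer⇓ h = h
  complete-tag k (suc zero)    e v 2 K eq refl refl proj⇓ h =
    subst (λ r → Halts (r , K)) (lookup-clampFin 0 v (π₂ e)) h
  complete-tag k (suc (suc n)) e v 2 K eq refl refl proj⇓ h =
    subst (λ r → Halts (r , K)) (lookup-clampFin (suc n) v (π₂ e)) h
  complete-tag k zero          e v 3 K eq refl eqv (comp⇓ ds d) h = complete-comp k 0 e v K eqv ds d h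
  complete-tag k (suc zero)    e v 3 K eq refl eqv (comp⇓ ds d) h = complete-comp k 1 e v K eqv ds d h
  complete-tag k (suc (suc n)) e v 3 K eq refl eqv (comp⇓ ds d) h = complete-comp k (2 + n) e v K eqv ds d h
  complete-tag k zero          e v 4 K eq refl refl zer⇓ h = h
  complete-tag k (suc zero)    e v 4 K eq refl refl d h = complete-prec k 0 e v (π₁ v) K eq d h
  complete-tag k (suc (suc n)) e v 4 K eq refl refl d h = complete-prec k (suc n) e v (π₁ v) K eq d h
  complete-tag k zero          e v 5 K eq refl refl (mu⇓ s) h = complete-search k 0 (π₂ e) v 0 K s h
  complete-tag k (suc zero)    e v 5 K eq refl refl (mu⇓ s) h = complete-search k 1 (π₂ e) v 0 K s h
  complete-tag k (suc (suc n)) e v 5 K eq refl refl (mu⇓ s) h = complete-search k (2 + n) (π₂ e) v 0 K s h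
  complete-tag k zero          e v (suc (suc (suc (suc (suc (suc _)))))) K eq refl refl zer⇓ h = h
  complete-tag k (suc zero)    e v (suc (suc (suc (suc (suc (suc _)))))) K eq refl refl zer⇓ h = h
  complete-tag k (suc (suc n)) e v (suc (suc (suc (suc (suc (suc _)))))) K eq refl refl zer⇓ h = h

  complete-comp : ∀ k n e v {xs ys r} K → decodeArgs n v ≡ xs →
    decodeVec k (π₁ (π₂ e)) n (π₂ (π₂ (π₂ e))) [ xs ]⇓* ys →
    decode k (π₁ (π₂ e)) (π₁ (π₂ (π₂ e))) [ ys ]⇓ r →
    Halts (r , K) → Halts (stepTag k n e v 3 K)
  complete-comp k n e v {ys = ys} K eqv ds d h = complete-vec k _ n _ v 0 _ refl eqv ds
    (halts-step (complete k _ _ (encodeArgs ys) 0 K refl (decodeArgs-encodeArgs ys) d h))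

  complete-vec : ∀ k m n c v {cs xs ys} y K → decodeVec k m n c ≡ cs → decodeArgs n v ≡ xs →
    cs [ xs ]⇓* ys → Halts (encodeArgs ys , K) → Halts (y , EVALS k m n c v ∷ K)
  complete-vec k zero    n c v y K refl eqv []⇓ h = halts-step h
  complete-vec k (suc m) n c v y K refl eqv (d ∷⇓ ds) h =
    halts-step (complete k n (π₁ c) v 0 _ refl eqv d
      (halts-step (complete-vec k m n (π₂ c) v 0 _ refl eqv ds (halts-step h))))

  complete-prec : ∀ k n e v i {r} K → π₁ e ≡ 4 →
    decodePrec k n (unpair (π₂ e)) [ i ∷ decodeArgs n (π₂ v) ]⇓ r →
    Halts (r , K) → Halts (stepPrec k (suc n) e v i K)
  complete-prec k n e v zero    K eq (prec₀⇓ d) h = complete k n _ (π₂ v) 0 K refl refl d h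
  complete-prec k n e v (suc i) K eq (precₛ⇓ {r = r} d d′) h =
    complete (suc k) (suc n) e _ 0 _
      (trans (cong (λ t → decodeTag k (suc n) (t , π₂ e)) eq) (decodeTag-prec k n (π₂ e)))
      (decodeArgs-⟪⟫ i (π₂ v)) d
      (halts-step (complete k (2 + n) _ _ 0 K refl
        (trans (decodeArgs-⟪⟫ i _) (cong (i ∷_) (decodeArgs-⟪⟫ r (π₂ v)))) d′ h))

  complete-search : ∀ k n f v x {z} K → Search (decode k (suc n) f) (decodeArgs n v) x z →
    Halts (z , K) → Halts (0 , EVAL k (suc n) f ⟪ x , v ⟫ ∷ MU k (suc n) f v x ∷ K)
  complete-search k n f v x K (stop d)   h =
    complete k (suc n) f _ 0 _ refl (decodeArgs-⟪⟫ x v) d (halts-step h)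
  complete-search k n f v x K (next d s) h =
    complete k (suc n) f _ 0 _ refl (decodeArgs-⟪⟫ x v) d
      (halts-step (complete-search k n f v (suc x) K s h))

start : ℕ → ℕ → State
start e x = 0 , EVAL (suc e) 1 e ⟪ x , 0 ⟫ ∷ []

W⇔Halts : ∀ e x → W e x ⇔ Halts (start e x)
W⇔Halts e x = mk⇔ ⇒ ⇐
  where
  ⇒ : W e x → Halts (start e x)
  ⇒ w with to (W⇔⇓ e x) w
  ... | y , d = complete (suc e) 1 e _ 0 [] refl (decodeArgs-⟪⟫ x 0) d (0 , refl)
  ⇐ : Halts (start e x) → W e x
  ⇐ (t , h) with sound-run t (start e x) (subst (λ K → ⟦ K ⟧ (proj₁ (run t (start e x)))) (sym h) tt)
  ... | y , d , _ = from (W⇔⇓ e x) (y , ⇓-cong refl (decodeArgs-⟪⟫ x 0) d)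

-- The machine on numbers

-- One layout for all frames lets a single dispatch on the tag read every field; unneeded fields are
-- 0. Tags start at 1, which separates every frame from the empty stack 0.
frame# : (t k m n c v K : ℕ) → ℕ
frame# t k m n c v K = ⟪ t , ⟪ k , ⟪ m , ⟪ n , ⟪ c , ⟪ v , K ⟫ ⟫ ⟫ ⟫ ⟫ ⟫

stack# : List Frame → ℕ
stack# []                     = 0
stack# (EVAL k n e v ∷ K)     = frame# 1 k 0 n e v (stack# K)
stack# (EVALS k m n c v ∷ K)  = frame# 2 k m n c v (stack# K)
stack# (TAIL k m n c v ∷ K)   = frame# 3 k m n c v (stack# K)
stack# (CONS y ∷ K)           = frame# 4 0 0 0 0 y (stack# K)
stack# (CALL k m f ∷ K)       = frame# 5 k m 0 f 0 (stack# K)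
stack# (REC k n g i v ∷ K)    = frame# 6 k i n g v (stack# K)
stack# (MU k n f v y ∷ K)     = frame# 7 k y n f v (stack# K)

state# : State → ℕ
state# (y , K) = ⟪ y , stack# K ⟫

switch : Fn n → List (Fn n) → Fn n → Fn n
switch C []       D = D
switch C (F ∷ Fs) D = ifzF C F (switch (predF C) Fs D)

frameF : (T K M N C V R : Fn n) → Fn n
frameF T K M N C V R = pairF T (pairF K (pairF M (pairF N (pairF C (pairF V R)))))

module Dispatch where

  T K M N C V R Y ret₀ : Fn 8
  T = var 0F
  K = var 1F
  M = var 2F
  N = var 3F
  C = var 4F
  V = var 5F
  R = var 6F
  Y = var 7F

  ret₀ = pairF (cst 0) R

  evalF : (K N C V R : Fn 8) → Fn 8
  evalF K = frameF (cst 1) K (cst 0)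

  stepPrecF stepTagF dispatchF : Fn 8
  -- The fuel and arity fields are positive here: the recursive call passes them on unchanged, the
  -- other frames use predecessors.
  stepPrecF = pairF (cst 0) (ifzF (π₁F V)
    (evalF (predF K) (predF N) (π₁F (π₂F C)) (π₂F V) R)
    (evalF K N C (pairF (predF (π₁F V)) (π₂F V))
      (frameF (cst 6) (predF K) (predF (π₁F V)) (sucF N) (π₂F (π₂F C)) (π₂F V) R)))

  stepTagF = switch (π₁F C)
    ( ret₀
    ∷ ifzF (eqF N (cst 1)) (pairF (sucF (π₁F V)) R) ret₀
    ∷ ifzF N ret₀ (pairF (nthF V (ifzF (π₂F C ∸F predF N) (π₂F C) (predF N))) R)
    ∷ pairF (cst 0) (frameF (cst 2) (predF K) (π₁F (π₂F C)) N (π₂F (π₂F (π₂F C))) V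
        (frameF (cst 5) (predF K) (π₁F (π₂F C)) (cst 0) (π₁F (π₂F (π₂F C))) (cst 0) R))
    ∷ ifzF N ret₀ stepPrecF
    ∷ pairF (cst 0) (evalF (predF K) (sucF N) (π₂F C) (pairF (cst 0) V)
        (frameF (cst 7) (predF K) (cst 0) (sucF N) (π₂F C) V R))
    ∷ [] ) ret₀

  dispatchF = switch T
    ( pairF Y (cst 0)
    ∷ ifzF K ret₀ stepTagF
    ∷ ifzF M ret₀ (pairF (cst 0) (evalF K N (π₁F C) V (frameF (cst 3) K (predF M) N (π₂F C) V R)))
    ∷ pairF (cst 0) (frameF (cst 2) K M N C V (frameF (cst 4) (cst 0) (cst 0) (cst 0) (cst 0) Y R))
    ∷ pairF (pairF V Y) R
    ∷ pairF (cst 0) (evalF K M C Y R)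
    ∷ pairF (cst 0) (evalF K N C (pairF M (pairF Y V)) R)
    ∷ ifzF Y (pairF M R) (pairF (cst 0) (evalF K N C (pairF (sucF M) V) (frameF (cst 7) K (sucF M) N C V R)))
    ∷ [] ) ret₀

  fieldsF : Vec (Fn 1) 8
  fieldsF = π₁F S ∷ π₁F (π₂F S) ∷ π₁F (π₂F (π₂F S)) ∷ π₁F (π₂F (π₂F (π₂F S)))
          ∷ π₁F (π₂F (π₂F (π₂F (π₂F S)))) ∷ π₁F (π₂F (π₂F (π₂F (π₂F (π₂F S)))))
          ∷ π₂F (π₂F (π₂F (π₂F (π₂F (π₂F S))))) ∷ π₁F (var 0F) ∷ []
    where S = π₂F (var 0F)

open Dispatch using (stepPrecF; stepTagF; dispatchF; fieldsF)

stepF : Fn 1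
stepF = app dispatchF fieldsF

step# : ℕ → ℕ
step# z = sem stepF (z ∷ [])

step#-frame : ∀ y t k m n c v K →
  step# ⟪ y , frame# t k m n c v K ⟫ ≡ sem dispatchF (t ∷ k ∷ m ∷ n ∷ c ∷ v ∷ K ∷ y ∷ [])
step#-frame y t k m n c v K = cong (sem dispatchF) fields≡
  where
  fields≡ : sems fieldsF (⟪ y , frame# t k m n c v K ⟫ ∷ []) ≡ t ∷ k ∷ m ∷ n ∷ c ∷ v ∷ K ∷ y ∷ []
  fields≡ rewrite unpair-⟪⟫ y (frame# t k m n c v K)
                | unpair-⟪⟫ t ⟪ k , ⟪ m , ⟪ n , ⟪ c , ⟪ v , K ⟫ ⟫ ⟫ ⟫ ⟫
                | unpair-⟪⟫ k ⟪ m , ⟪ n , ⟪ c , ⟪ v , K ⟫ ⟫ ⟫ ⟫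
                | unpair-⟪⟫ m ⟪ n , ⟪ c , ⟪ v , K ⟫ ⟫ ⟫
                | unpair-⟪⟫ n ⟪ c , ⟪ v , K ⟫ ⟫
                | unpair-⟪⟫ c ⟪ v , K ⟫
                | unpair-⟪⟫ v K = refl

stepPrec# : ∀ k n e v y K → sem stepPrecF (1 ∷ suc k ∷ 0 ∷ suc n ∷ e ∷ v ∷ stack# K ∷ y ∷ []) ≡
                            state# (stepPrec k (suc n) e v (π₁ v) K)
stepPrec# k n e v y K with π₁ v
... | zero  = refl
... | suc i = refl

stepTag# : ∀ k n e v y K → sem stepTagF (1 ∷ suc k ∷ 0 ∷ n ∷ e ∷ v ∷ stack# K ∷ y ∷ []) ≡
                           state# (stepTag k n e v (π₁ e) K)
stepTag# k n e v y K with π₁ e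
stepTag# k n             e v y K | 0 = refl
stepTag# k zero          e v y K | 1 = refl
stepTag# k (suc zero)    e v y K | 1 = refl
stepTag# k (suc (suc n)) e v y K | 1 = refl
stepTag# k zero          e v y K | 2 = refl
stepTag# k (suc n)       e v y K | 2 = refl
stepTag# k n             e v y K | 3 = refl
stepTag# k zero          e v y K | 4 = refl
stepTag# k (suc n)       e v y K | 4 = stepPrec# k n e v y K
stepTag# k n             e v y K | 5 = refl
stepTag# k n             e v y K | suc (suc (suc (suc (suc (suc _))))) = refl

step#-state : ∀ σ → step# (state# σ) ≡ state# (step σ)
step#-state (y , []) rewrite unpair-⟪⟫ y 0 = refl
step#-state (y , EVAL zero n e v ∷ K) = step#-frame y 1 0 0 n e v (stack# K)
step#-state (y , EVAL (suc k) n e v ∷ K) =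
  trans (step#-frame y 1 (suc k) 0 n e v (stack# K)) (stepTag# k n e v y K)
step#-state (y , EVALS k zero n c v ∷ K) = step#-frame y 2 k 0 n c v (stack# K)
step#-state (y , EVALS k (suc m) n c v ∷ K) = step#-frame y 2 k (suc m) n c v (stack# K)
step#-state (y , TAIL k m n c v ∷ K) = step#-frame y 3 k m n c v (stack# K)
step#-state (y , CONS x ∷ K) = step#-frame y 4 0 0 0 0 x (stack# K)
step#-state (y , CALL k m f ∷ K) = step#-frame y 5 k m 0 f 0 (stack# K)
step#-state (y , REC k n g i v ∷ K) = step#-frame y 6 k i n g v (stack# K)
step#-state (zero , MU k n f v x ∷ K) = step#-frame zero 7 k x n f v (stack# K)
step#-state (suc r , MU k n f v x ∷ K) = step#-frame (suc r) 7 k x n f v (stack# K)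

run# : ∀ t e x → recurse (state# (start e x)) (λ _ → step#) t ≡ state# (run t (start e x))
run# zero    e x = refl
run# (suc t) e x = trans (cong step# (run# t e x)) (step#-state (run t (start e x)))

top : List Frame → ℕ
top K = π₁ (stack# K)

top≡0⇒[] : ∀ K → top K ≡ 0 → K ≡ []
top≡0⇒[] [] eq = refl
top≡0⇒[] (EVAL k n e v ∷ K)    eq with () ← trans (sym (π₁-⟪⟫ 1 _)) eq
top≡0⇒[] (EVALS k m n c v ∷ K) eq with () ← trans (sym (π₁-⟪⟫ 2 _)) eq
top≡0⇒[] (TAIL k m n c v ∷ K)  eq with () ← trans (sym (π₁-⟪⟫ 3 _)) eq
top≡0⇒[] (CONS y ∷ K)          eq with () ← trans (sym (π₁-⟪⟫ 4 _)) eq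
top≡0⇒[] (CALL k m f ∷ K)      eq with () ← trans (sym (π₁-⟪⟫ 5 _)) eq
top≡0⇒[] (REC k n g i v ∷ K)   eq with () ← trans (sym (π₁-⟪⟫ 6 _)) eq
top≡0⇒[] (MU k n f v y ∷ K)    eq with () ← trans (sym (π₁-⟪⟫ 7 _)) eq

abstract
  -- The tag of the top frame after t steps: 0 exactly when the machine has stopped, which turns
  -- halting into a total test monotone in t.
  halt : ℕ → ℕ → ℕ → ℕ
  halt e x t = top (proj₂ (run t (start e x)))

  halt-mono : ∀ e x {t t′} → t ≤ t′ → halt e x t ≡ 0 → halt e x t′ ≡ 0
  halt-mono e x {t} t≤t′ eq =
    cong top (haltsIn-mono (start e x) (≤⇒≤′ t≤t′) (top≡0⇒[] (proj₂ (run t (start e x))) eq))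

  W⇔halt : ∀ e x → W e x ⇔ ∃ λ t → halt e x t ≡ 0
  W⇔halt e x = mk⇔
    (λ w → let t , h = to (W⇔Halts e x) w in t , cong top h)
    (λ { (t , eq) → from (W⇔Halts e x) (t , top≡0⇒[] (proj₂ (run t (start e x))) eq) })

  haltPR : Fn 3
  haltPR = π₁F (π₂F (precF
    (pairF (cst 0) (frameF (cst 1) (sucF (var 0F)) (cst 0) (cst 1) (var 0F) (pairF (var 1F) (cst 0)) (cst 0)))
    (app₁ stepF (var 1F))))

  sem-haltPR : ∀ t e x → sem haltPR (t ∷ e ∷ x ∷ []) ≡ halt e x t
  sem-haltPR t e x = cong π₁ (trans (cong π₂ (run# t e x)) (π₂-⟪⟫ _ _))

haltF : Fn n → Fn n → Fn n → Fn n
haltF E X S = refine (app haltPR (S ∷ E ∷ X ∷ [])) (λ xs → halt (sem E xs) (sem X xs) (sem S xs))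
  (λ xs → sem-haltPR (sem S xs) (sem E xs) (sem X xs))

-- The upper bound

τ₁ τ₂ τ₃ : ℕ → ℕ
τ₁ z = π₁ z
τ₂ z = π₁ (π₂ z)
τ₃ z = π₂ (π₂ z)

triple : ℕ → ℕ → ℕ → ℕ
triple a b c = ⟪ a , ⟪ b , c ⟫ ⟫

-- `f` may be a predicate, so a whole proposition about the three projections is transported at
-- once.
τ-triple : ∀ {ℓ} {A : Set ℓ} (f : ℕ → ℕ → ℕ → A) a b c → let z = triple a b c in
           f (τ₁ z) (τ₂ z) (τ₃ z) ≡ f a b c
τ-triple f a b c rewrite unpair-⟪⟫ a ⟪ b , c ⟫ | unpair-⟪⟫ b c = refl

-- Monotone witnesses for finitely many i are replaced by their maximum; this moves an existential
-- quantifier across a bounded universal one.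
collect : ∀ n {P : ℕ → ℕ → Set} → (∀ {i t t′} → t ≤ t′ → P i t → P i t′) →
          (∀ i → i < n → ∃ λ t → P i t) → ∃ λ t → ∀ i → i < n → P i t
collect zero    mono p = 0 , λ _ ()
collect (suc n) {P} mono p with collect n mono (λ i i<n → p i (m<n⇒m<1+n i<n)) | p n (n<1+n n)
... | t₁ , q₁ | t₂ , q₂ = t₁ ⊔ t₂ , go
  where
  go : ∀ i → i < suc n → P i (t₁ ⊔ t₂)
  go i i<1+n with m<1+n⇒m<n∨m≡n i<1+n
  ... | inj₁ i<n  = mono (m≤m⊔n t₁ t₂) (q₁ i i<n)
  ... | inj₂ refl = mono (m≤n⊔m t₁ t₂) q₂

entries : ℕ → ℕ → List ℕ
entries zero    σ = []
entries (suc l) σ = π₁ σ ∷ entries l (π₂ σ)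

length-entries : ∀ l σ → length (entries l σ) ≡ l
length-entries zero    σ = refl
length-entries (suc l) σ = cong suc (length-entries l (π₂ σ))

entries-surjective : ∀ S → ∃ λ σ → entries (length S) σ ≡ S
entries-surjective [] = 0 , refl
entries-surjective (x ∷ S) with entries-surjective S
... | σ , eq = ⟪ x , σ ⟫ , cong₂ _∷_ (π₁-⟪⟫ x σ)
                             (trans (cong (entries (length S)) (π₂-⟪⟫ x σ)) eq)

All-entries⁺ : ∀ {P : ℕ → Set} l σ → (∀ i → i < l → P (nth σ i)) → All P (entries l σ)
All-entries⁺ zero    σ p = []
All-entries⁺ (suc l) σ p = p 0 (s≤s z≤n) ∷ All-entries⁺ l (π₂ σ) (λ i i<l → p (suc i) (s≤s i<l))

All-entries⁻ : ∀ {P : ℕ → Set} l σ → All P (entries l σ) → ∀ i → i < l → P (nth σ i)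
All-entries⁻ (suc l) σ (p ∷ ps) zero    _         = p
All-entries⁻ (suc l) σ (p ∷ ps) (suc i) (s≤s i<l) = All-entries⁻ l (π₂ σ) ps i i<l

In : ℕ → ℕ → ℕ → ℕ → Set
In e j x t = halt e ⟪ j , x ⟫ t ≡ 0

L⇔In : ∀ e j x → L e j x ⇔ ∃ (In e j x)
L⇔In e j x = subst (λ z → W e z ⇔ ∃ (In e j x)) (⟪⟫≡pair j x) (W⇔halt e ⟪ j , x ⟫)

In-mono : ∀ e j x {t t′} → t ≤ t′ → In e j x t → In e j x t′
In-mono e j x = halt-mono e ⟪ j , x ⟫

-- A candidate teaching set is ⟨l,⟨σ,s⟩⟩: its entries are σ₀, …, σ_{l-1}, and s steps suffice to
-- enumerate them into L_j.  A challenge ⟨j′,⟨q,t⟩⟩ to it asks whether L_j and L_j′ agree at q.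
premise : (e j l σ j′ q t : ℕ) → ℕ
premise e j l σ j′ q t =
  all< l (λ i → halt e ⟪ j′ , nth σ i ⟫ t) + halt e ⟪ j , q ⟫ t * halt e ⟪ j′ , q ⟫ t

conclusion : (e j j′ q u : ℕ) → ℕ
conclusion e j j′ q u = halt e ⟪ j , q ⟫ u + halt e ⟪ j′ , q ⟫ u

-- The summands are the size bound, S ⊆ L_j, and an implication: a false premise gives 0. The
-- premise says that by stage t S lies in L_j′ and q in one of the two languages, the conclusion
-- that q lies in both. As t belongs to the challenge and u is the answer, this expresses that S ⊆
-- L_j′ forces equality.
matrix : (e k j l σ s j′ q t u : ℕ) → ℕ
matrix e k j l σ s j′ q t u =
  (l ∸ k) + all< l (λ i → halt e ⟪ j , nth σ i ⟫ s) +
  ifz (premise e j l σ j′ q t) (conclusion e j j′ q u) 0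

-- The arguments are e, k, j, candidate, challenge and u; inside `all<F` their positions are shifted
-- by one.
matrixF : Fn 6
matrixF =
  (τ₁F (var 3F) ∸F var 1F) +F
  all<F (τ₁F (var 3F)) (haltF (var 1F) (pairF (var 3F) (nthF (τ₂F (var 4F)) (var 0F))) (τ₃F (var 4F))) +F
  ifzF (all<F (τ₁F (var 3F))
          (haltF (var 1F) (pairF (τ₁F (var 5F)) (nthF (τ₂F (var 4F)) (var 0F))) (τ₃F (var 5F))) +F
        haltF (var 0F) (pairF (var 2F) (τ₂F (var 4F))) (τ₃F (var 4F)) *F
        haltF (var 0F) (pairF (τ₁F (var 4F)) (τ₂F (var 4F))) (τ₃F (var 4F)))
       (haltF (var 0F) (pairF (var 2F) (τ₂F (var 4F))) (var 5F) +F
        haltF (var 0F) (pairF (τ₁F (var 4F)) (τ₂F (var 4F))) (var 5F))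
       (cst 0)
  where
  τ₁F τ₂F τ₃F : ∀ {n} → Fn n → Fn n
  τ₁F F = π₁F F
  τ₂F F = π₁F (π₂F F)
  τ₃F F = π₂F (π₂F F)

module UpperBound (em : ExcludedMiddle 0ℓ) (e k j : ℕ) where

  Teaches : ℕ → ℕ → Set
  Teaches c d = ∃ λ u → matrix e k j (τ₁ c) (τ₂ c) (τ₃ c) (τ₁ d) (τ₂ d) (τ₃ d) u ≡ 0

  TD⁺≤⇒Teaches : TD⁺≤ e j k → ∃ λ c → ∀ d → Teaches c d
  TD⁺≤⇒Teaches (S , |S|≤k , S⊆L , teaches) with entries-surjective S
  ... | σ , eq = c , λ d → subst id (sym (τ-triple (λ l σ s → ∃ λ u → matrix e k j l σ s (τ₁ d) (τ₂ d) (τ₃ d) u ≡ 0) l σ s))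
                                 (go (τ₁ d) (τ₂ d) (τ₃ d))
    where
    l = length S
    all-In : ∃ λ s → ∀ i → i < l → In e j (nth σ i) s
    all-In = collect l (λ {i} → In-mono e j (nth σ i)) λ i i<l →
      to (L⇔In e j (nth σ i)) (All-entries⁻ l σ (subst (All (L e j)) (sym eq) S⊆L) i i<l)
    s = proj₁ all-In
    c = triple l σ s
    core : ∀ j′ q t → ∃ λ u → ifz (premise e j l σ j′ q t) (conclusion e j j′ q u) 0 ≡ 0
    core j′ q t with premise e j l σ j′ q t in prem
    ... | suc _ = 0 , refl
    ... | zero  = both
      where
      S⊆L′ : All (L e j′) S
      S⊆L′ = subst (All (L e j′)) eq (All-entries⁺ l σ λ i i<l →
        from (L⇔In e j′ (nth σ i)) (t , all<-sound l _ (m+n≡0⇒m≡0 (all< l _) prem) i i<l))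
      both : ∃ λ u → conclusion e j j′ q u ≡ 0
      -- A teaching set yields equality only doubly negated; excluded middle removes the negations.
      both with em {P = L e j′ ≐ L e j}
      ... | no  L′≠L = contradiction (S⊆L′ , L′≠L) (teaches j′)
      ... | yes L′≐L with m*n≡0⇒m≡0∨n≡0 (halt e ⟪ j , q ⟫ t) (m+n≡0⇒n≡0 (all< l _) prem)
      ...   | inj₁ h with to (L⇔In e j′ q) (from (L′≐L q) (from (L⇔In e j q) (t , h)))
      ...     | t′ , h′ = t ⊔ t′ , cong₂ _+_ (In-mono e j q (m≤m⊔n t t′) h) (In-mono e j′ q (m≤n⊔m t t′) h′)
      both | yes L′≐L | inj₂ h′ with to (L⇔In e j q) (to (L′≐L q) (from (L⇔In e j′ q) (t , h′)))
      ...     | t′ , h = t ⊔ t′ , cong₂ _+_ (In-mono e j q (m≤n⊔m t t′) h) (In-mono e j′ q (m≤m⊔n t t′) h′)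
    go : ∀ j′ q t → ∃ λ u → matrix e k j l σ s j′ q t u ≡ 0
    go j′ q t with core j′ q t
    ... | u , eq′ = u , cong₂ _+_ (cong₂ _+_ (m≤n⇒m∸n≡0 |S|≤k) (all<-complete l _ (proj₂ all-In))) eq′

  Teaches⇒TD⁺≤ : (∃ λ c → ∀ d → Teaches c d) → TD⁺≤ e j k
  Teaches⇒TD⁺≤ (c , h) = entries l σ , |S|≤k , S⊆L , λ { j′ (S⊆L′ , L′≠L) → L′≠L (coincide j′ S⊆L′) }
    where
    l = τ₁ c
    σ = τ₂ c
    s = τ₃ c
    bounds : (l ∸ k) + all< l (λ i → halt e ⟪ j , nth σ i ⟫ s) ≡ 0
    -- These summands do not mention the challenge, so any challenge, here 0, provides them.
    bounds = m+n≡0⇒m≡0 _ (proj₂ (h 0))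
    |S|≤k : length (entries l σ) ≤ k
    |S|≤k = subst (_≤ k) (sym (length-entries l σ)) (m∸n≡0⇒m≤n (m+n≡0⇒m≡0 (l ∸ k) bounds))
    S⊆L : All (L e j) (entries l σ)
    S⊆L = All-entries⁺ l σ λ i i<l →
      from (L⇔In e j _) (s , all<-sound l _ (m+n≡0⇒n≡0 (l ∸ k) bounds) i i<l)
    agree : ∀ j′ → All (L e j′) (entries l σ) → ∀ x t →
            halt e ⟪ j , x ⟫ t * halt e ⟪ j′ , x ⟫ t ≡ 0 → L e j x × L e j′ x
    agree j′ S⊆L′ x t hx with collect l (λ {i} → In-mono e j′ (nth σ i))
                                      (λ i i<l → to (L⇔In e j′ (nth σ i)) (All-entries⁻ l σ S⊆L′ i i<l))
    ... | t₁ , h₁ = from (L⇔In e j x) (u , m+n≡0⇒m≡0 _ concl) , from (L⇔In e j′ x) (u , m+n≡0⇒n≡0 _ concl)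
      where
      -- By this stage both x has appeared and S has been enumerated into L_j′, so the challenge
      -- with t′ has a true premise.
      t′ = t ⊔ t₁
      later : halt e ⟪ j , x ⟫ t′ * halt e ⟪ j′ , x ⟫ t′ ≡ 0
      later with m*n≡0⇒m≡0∨n≡0 (halt e ⟪ j , x ⟫ t) hx
      ... | inj₁ h = cong (_* halt e ⟪ j′ , x ⟫ t′) (In-mono e j x (m≤m⊔n t t₁) h)
      ... | inj₂ h = trans (cong (halt e ⟪ j , x ⟫ t′ *_) (In-mono e j′ x (m≤m⊔n t t₁) h)) (*-zeroʳ (halt e ⟪ j , x ⟫ t′))
      prem : premise e j l σ j′ x t′ ≡ 0
      prem = cong₂ _+_ (all<-complete l _ λ i i<l → In-mono e j′ _ (m≤n⊔m t t₁) (h₁ i i<l)) later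
      answer : ∃ λ u → matrix e k j l σ s j′ x t′ u ≡ 0
      answer = subst id (τ-triple (λ j′ x t → ∃ λ u → matrix e k j l σ s j′ x t u ≡ 0) j′ x t′)
                     (h (triple j′ x t′))
      u = proj₁ answer
      concl : conclusion e j j′ x u ≡ 0
      concl = subst (λ p → ifz p (conclusion e j j′ x u) 0 ≡ 0) prem
                    (m+n≡0⇒n≡0 ((l ∸ k) + _) (proj₂ answer))
    coincide : ∀ j′ → All (L e j′) (entries l σ) → L e j′ ≐ L e j
    coincide j′ S⊆L′ x = mk⇔ into outof
      where
      into : L e j′ x → L e j x
      into p with to (L⇔In e j′ x) p
      ... | t , h = proj₁ (agree j′ S⊆L′ x t (trans (cong (halt e ⟪ j , x ⟫ t *_) h) (*-zeroʳ (halt e ⟪ j , x ⟫ t))))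
      outof : L e j x → L e j′ x
      outof p with to (L⇔In e j x) p
      ... | t , h = proj₂ (agree j′ S⊆L′ x t (cong (_* halt e ⟪ j′ , x ⟫ t) h))

I-TD⁺∈Σ⁰₅ : ExcludedMiddle 0ℓ → Σ⁰₅ I-TD⁺
I-TD⁺∈Σ⁰₅ em = prog matrixF , Fn-total matrixF , λ e → mk⇔ (⇒ e) (⇐ e)
  where
  open UpperBound em
  ⇒ : ∀ e → I-TD⁺ e → ∃ λ k → ∀ j → ∃ λ c → ∀ d → ∃ λ u → Holds (prog matrixF) (e ∷ k ∷ j ∷ c ∷ d ∷ u ∷ [])
  ⇒ e (k , h) = k , λ j → let c , p = TD⁺≤⇒Teaches e k j (h j) in
    c , λ d → let u , eq = p d in u , from (Holds⇔sem matrixF _) eq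
  ⇐ : ∀ e → (∃ λ k → ∀ j → ∃ λ c → ∀ d → ∃ λ u → Holds (prog matrixF) (e ∷ k ∷ j ∷ c ∷ d ∷ u ∷ [])) → I-TD⁺ e
  ⇐ e (k , h) = k , λ j → let c , p = h j in Teaches⇒TD⁺≤ e k j (c , λ d →
    let u , q = p d in u , to (Holds⇔sem matrixF _) q)

-- The hard family

-- If all of 0, ..., k occurred, two of them would share a position in a list of length at most k.
missing : ∀ {k} (xs : List ℕ) → length xs ≤ k → ∃ λ i → i ≤ k × i ∉ xs
missing {k} xs |xs|≤k with all? {suc k} (λ i → toℕ i ∈? xs)
... | no ¬all with ¬∀⟶∃¬ (suc k) (λ i → toℕ i ∈ xs) (λ i → toℕ i ∈? xs) ¬all
...   | i , i∉xs = toℕ i , s≤s⁻¹ (toℕ<n i) , i∉xs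
missing {k} xs |xs|≤k | yes all with pigeonhole (s≤s |xs|≤k) (index ∘ all)
... | i , j , i<j , eq = contradiction
  (toℕ-injective (trans (lookup-index (all i)) (trans (cong (List.lookup xs) eq) (sym (lookup-index (all j))))))
  (<⇒≢ᶠ i<j)

bound : ∀ (f : ℕ → ℕ) xs → ∃ λ p → All (λ x → f x ≤ p) xs
bound f [] = 0 , []
bound f (x ∷ xs) with bound f xs
... | p , ps = f x ⊔ p , m≤m⊔n (f x) p ∷ All.map (λ le → ≤-trans le (m≤n⊔m (f x) p)) ps

TeachableWithin : (ℕ → ℕ → Set) → ℕ → ℕ → Set
TeachableWithin M k j = ∃ λ S → length S ≤ k × All (M j) S ×
  (∀ j′ → ¬ (All (M j′) S × ¬ (M j′ ≐ M j)))

-- Passing to an equivalent family also keeps the programs occurring in L out of the unifier.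
module _ {M : ℕ → ℕ → Set} (e : ℕ) (L⇔M : ∀ j x → L e j x ⇔ M j x) where

  private
    L→M : ∀ j {S} → All (L e j) S → All (M j) S
    L→M j = All.map (λ {x} → to (L⇔M j x))

    M→L : ∀ j {S} → All (M j) S → All (L e j) S
    M→L j = All.map (λ {x} → from (L⇔M j x))

  TD⁺≤⇒TeachableWithin : ∀ {k j} → TD⁺≤ e j k → TeachableWithin M k j
  TD⁺≤⇒TeachableWithin {k} {j} (S , |S|≤k , S⊆L , h) = S , |S|≤k , L→M j S⊆L ,
    λ { j′ (S⊆M , ≠) → h j′ (M→L j′ S⊆M , λ same → ≠ λ x → mk⇔
      (λ p → to (L⇔M j x) (to (same x) (from (L⇔M j′ x) p)))
      (λ p → to (L⇔M j′ x) (from (same x) (from (L⇔M j x) p)))) }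

  TeachableWithin⇒TD⁺≤ : ∀ {k j} → TeachableWithin M k j → TD⁺≤ e j k
  TeachableWithin⇒TD⁺≤ {k} {j} (S , |S|≤k , S⊆M , h) = S , |S|≤k , M→L j S⊆M ,
    λ { j′ (S⊆L , ≠) → h j′ (L→M j′ S⊆L , λ same → ≠ λ x → mk⇔
      (λ p → from (L⇔M j x) (to (same x) (to (L⇔M j′ x) p)))
      (λ p → from (L⇔M j′ x) (from (same x) (to (L⇔M j x) p)))) }

-- The family and its enumeration

module Family (R : Fn 6) where

  r : (x a b c d e : ℕ) → ℕ
  r x a b c d e = sem R (x ∷ a ∷ b ∷ c ∷ d ∷ e ∷ [])

  -- `w` bounds the search for e, so that the Σ₁ collapse condition is "some w" applied to a
  -- decidable test.
  collW : (w x β i p s : ℕ) → ℕ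
  collW w x β i p s =
    ex< i λ a → ex< p λ c → all< s λ d → ex< w λ e → r x a (nth β a) c d e

  collF : Fn 6
  -- Each quantifier puts its variable in front and shifts w, x, β, i, p, s by one.
  collF = ex<F (var 3F) (ex<F (var 5F) (all<F (var 7F) (ex<F (var 3F)
    (app R (var 5F ∷ var 3F ∷ nthF (var 6F) (var 3F) ∷ var 2F ∷ var 1F ∷ var 0F ∷ [])))))

  dW : (j u : ℕ) → ℕ
  dW j u = not (eqN (π₁ u) (τ₁ j)) + (π₂ u ∸ τ₂ j)

  -- Products are disjunctions and sums conjunctions. The factor t is true for t = 0, so the main
  -- language gets every point of the form t′ = 0; `not t` reserves own private points for
  -- attackers.
  acceptW : (w x β t j β′ t′ u : ℕ) → ℕ
  acceptW w x β t j β′ t′ u = eqN β β′ + ifz t′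
    (t * dW j u * collW w x β (τ₁ j) (τ₂ j) (τ₃ j))
    (collW w x β (τ₁ u) (τ₂ u) (τ₃ u) * (not t + eqN u j))

  acceptF : Fn 3
  acceptF = eqF (π₁F J) (π₁F Y) +F ifzF T′
      (T *F (notF (eqF (π₁F U) (π₁F C)) +F (π₂F U ∸F π₁F (π₂F C))) *F collapse C)
      (collapse U *F (notF T +F eqF U C))
    where
    J Y T C T′ U : Fn 3
    J  = π₁F (var 2F)
    Y  = π₂F (var 2F)
    T  = π₁F (π₂F J)
    C  = π₂F (π₂F J)
    T′ = π₁F (π₂F Y)
    U  = π₂F (π₂F Y)
    collapse : Fn 3 → Fn 3
    collapse C = app collF (var 0F ∷ var 1F ∷ π₁F J ∷ π₁F C ∷ π₁F (π₂F C) ∷ π₂F (π₂F C) ∷ [])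

  open Enumeration acceptF public

  module _ (x : ℕ) where

    Collapse : (β i p s : ℕ) → Set
    Collapse β i p s = ∃ λ a → a < i × ∃ λ c → c < p × ∀ d → d < s → ∃ λ e → r x a (nth β a) c d e ≡ 0

    Collapsed : (β j : ℕ) → Set
    Collapsed β j = Collapse β (τ₁ j) (τ₂ j) (τ₃ j)

    collW-sound : ∀ w β i p s → collW w x β i p s ≡ 0 → Collapse β i p s
    collW-sound w β i p s eq with ex<-sound i _ eq
    ... | a , a<i , eq₁ with ex<-sound p _ eq₁
    ... | c , c<p , eq₂ = a , a<i , c , c<p , λ d d<s →
      let e , _ , eq₃ = ex<-sound w _ (all<-sound s _ eq₂ d d<s) in e , eq₃

    -- Only the finitely many d < s need a witness e, so one bound w serves them all.
    collW-complete : ∀ β i p s → Collapse β i p s → ∃ λ w → collW w x β i p s ≡ 0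
    collW-complete β i p s (a , a<i , c , c<p , h)
      with collect s {λ d w → ∃ λ e → e < w × r x a (nth β a) c d e ≡ 0}
             (λ { t≤t′ (e , e<t , eq) → e , <-≤-trans e<t t≤t′ , eq })
             (λ d d<s → let e , eq = h d d<s in suc e , e , n<1+n e , eq)
    ... | w , h′ = w , ex<-complete i _ a a<i (ex<-complete p _ c c<p (all<-complete s _ λ d d<s →
      let e , e<w , eq = h′ d d<s in ex<-complete w _ e e<w eq))

    Avoids : (j u : ℕ) → Set
    Avoids j u = π₁ u ≢ τ₁ j × π₂ u ≤ τ₂ j

    dW-sound : ∀ j u → dW j u ≡ 0 → Avoids j u
    dW-sound j u eq = ne , m∸n≡0⇒m≤n (m+n≡0⇒n≡0 (not (eqN (π₁ u) (τ₁ j))) eq)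
      where
      ne : π₁ u ≢ τ₁ j
      ne p = contradiction (trans (sym (cong not (trans (cong (λ v → eqN v (τ₁ j)) p) (eqN-complete (τ₁ j)))))
                                  (m+n≡0⇒m≡0 (not (eqN (π₁ u) (τ₁ j))) eq)) λ ()

    dW-complete : ∀ j u → Avoids j u → dW j u ≡ 0
    dW-complete j u (ne , le) with eqN (π₁ u) (τ₁ j) in eq
    ... | zero  = contradiction (eqN-sound (π₁ u) (τ₁ j) eq) ne
    ... | suc _ = m≤n⇒m∸n≡0 le

    -- Within block β: t = 0 is the main language and any other t the attacker j = ⟨i,⟨p,s⟩⟩;
    -- t′ = 0 is the point u = ⟨i′,n⟩ and any other t′ the private point of the attacker u.
    Element : (β t j t′ u : ℕ) → Set
    Element β t j zero     u = t ≡ 0 ⊎ Avoids j u ⊎ Collapsed β j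
    Element β t j (suc t′) u = Collapsed β u ⊎ t ≢ 0 × u ≡ j

    Member : ℕ → ℕ → Set
    Member J y = τ₁ J ≡ τ₁ y × Element (τ₁ J) (τ₂ J) (τ₃ J) (τ₂ y) (τ₃ y)

    accept-sound : ∀ w β t j β′ t′ u → acceptW w x β t j β′ t′ u ≡ 0 → β ≡ β′ × Element β t j t′ u
    accept-sound w β t j β′ t′ u eq = eqN-sound β β′ (m+n≡0⇒m≡0 (eqN β β′) eq) , go t′ (m+n≡0⇒n≡0 (eqN β β′) eq)
      where
      coll = λ j → collW w x β (τ₁ j) (τ₂ j) (τ₃ j)
      nonzero : ∀ t → not t ≡ 0 → t ≢ 0
      nonzero (suc t) _ ()
      go : ∀ t′ → ifz t′ (t * dW j u * coll j) (coll u * (not t + eqN u j)) ≡ 0 → Element β t j t′ u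
      go zero h with m*n≡0⇒m≡0∨n≡0 (t * dW j u) h
      ... | inj₂ c = inj₂ (inj₂ (collW-sound w β _ _ _ c))
      ... | inj₁ h′ with m*n≡0⇒m≡0∨n≡0 t h′
      ...   | inj₁ t≡0 = inj₁ t≡0
      ...   | inj₂ d   = inj₂ (inj₁ (dW-sound j u d))
      go (suc _) h with m*n≡0⇒m≡0∨n≡0 (coll u) h
      ... | inj₁ c  = inj₁ (collW-sound w β _ _ _ c)
      ... | inj₂ h′ = inj₂ (nonzero t (m+n≡0⇒m≡0 (not t) h′) , eqN-sound u j (m+n≡0⇒n≡0 (not t) h′))

    accept-complete : ∀ β t j t′ u → Element β t j t′ u → ∃ λ w → acceptW w x β t j β t′ u ≡ 0
    accept-complete β t j zero u (inj₁ refl) = 0 , trans (+-identityʳ (eqN β β)) (eqN-complete β)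
    accept-complete β t j zero u (inj₂ (inj₁ av)) = 0 , cong₂ _+_ (eqN-complete β)
      (cong (_* collW 0 x β (τ₁ j) (τ₂ j) (τ₃ j)) (trans (cong (t *_) (dW-complete j u av)) (*-zeroʳ t)))
    accept-complete β t j zero u (inj₂ (inj₂ col)) with collW-complete β _ _ _ col
    ... | w , eq = w , cong₂ _+_ (eqN-complete β) (trans (cong (t * dW j u *_) eq) (*-zeroʳ (t * dW j u)))
    accept-complete β t j (suc _) u (inj₁ col) with collW-complete β _ _ _ col
    ... | w , eq = w , cong₂ _+_ (eqN-complete β) (cong (_* (not t + eqN u j)) eq)
    accept-complete β zero j (suc _) u (inj₂ (t≢0 , eq)) = contradiction refl t≢0
    accept-complete β (suc t) j (suc _) u (inj₂ (t≢0 , refl)) = 0 , cong₂ _+_ (eqN-complete β)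
      (trans (cong (collW 0 x β (τ₁ u) (τ₂ u) (τ₃ u) *_) (eqN-complete u)) (*-zeroʳ (collW 0 x β (τ₁ u) (τ₂ u) (τ₃ u))))

    Acc : ℕ → ℕ → ℕ → Set
    Acc w J y = acceptW w x (τ₁ J) (τ₂ J) (τ₃ J) (τ₁ y) (τ₂ y) (τ₃ y) ≡ 0

    acceptF≡ : ∀ w J y → (sem acceptF (w ∷ x ∷ pair J y ∷ []) ≡ 0) ≡ Acc w J y
    acceptF≡ w J y = cong (λ z → acceptW w x (τ₁ (proj₁ z)) (τ₂ (proj₁ z)) (τ₃ (proj₁ z))
                                             (τ₁ (proj₂ z)) (τ₂ (proj₂ z)) (τ₃ (proj₂ z)) ≡ 0) (unpair-pair J y)

    L⇔Member : ∀ J y → L (smn x) J y ⇔ Member J y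
    L⇔Member J y = mk⇔
      (λ p → let w , eq = to (W-smn x (pair J y)) p in
        accept-sound w (τ₁ J) (τ₂ J) (τ₃ J) (τ₁ y) (τ₂ y) (τ₃ y) (subst id (acceptF≡ w J y) eq))
      (λ { (β≡β′ , el) → let w , eq = accept-complete (τ₁ J) (τ₂ J) (τ₃ J) (τ₂ y) (τ₃ y) el in
        from (W-smn x (pair J y)) (w , subst id (sym (acceptF≡ w J y))
          (subst (λ β → acceptW w x (τ₁ J) (τ₂ J) (τ₃ J) β (τ₂ y) (τ₃ y) ≡ 0) β≡β′ eq)) })

  -- Correctness of the reduction

  module Correctness (em : ExcludedMiddle 0ℓ) (x : ℕ) where

    dne : ∀ {P : Set} → ¬ ¬ P → P
    dne = em⇒dne em

    ¬∀⇒∃¬ : ∀ {P : ℕ → Set} → ¬ (∀ n → P n) → ∃ λ n → ¬ P n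
    ¬∀⇒∃¬ ¬all = dne λ ¬ex → ¬all λ n → dne λ ¬Pn → ¬ex (n , ¬Pn)

    -- If each i < n failed at some stage, by antitonicity all would fail at a common later stage,
    -- against the hypothesis at that stage.
    uniform : ∀ n {P : ℕ → ℕ → Set} → (∀ {i s s′} → s ≤ s′ → P i s′ → P i s) →
              (∀ s → ∃ λ i → i < n × P i s) → ∃ λ i → i < n × ∀ s → P i s
    uniform n {P} anti h = dne λ ¬ex →
      let s , ¬P = collect n {λ i s → ¬ P i s} (λ s≤s′ ¬P P → ¬P (anti s≤s′ P))
                     (λ i i<n → ¬∀⇒∃¬ λ all → ¬ex (i , i<n , all))
          i , i<n , Pis = h s
      in ¬P i i<n Pis

    Q : ℕ → ℕ → Set
    Q a b = ∃ λ c → ∀ d → ∃ λ e → r x a b c d e ≡ 0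

    -- A larger s tests more d, so the condition is antitone in s; the finite choices of a < i and
    -- then of c < p can be made independent of s.
    Collapse⇒Q : ∀ β i p → (∀ s → Collapse x β i p s) → ∃ λ a → a < i × Q a (nth β a)
    Collapse⇒Q β i p h
      with uniform i (λ { s≤s′ (c , c<p , g) → c , c<p , λ d d<s → g d (<-≤-trans d<s s≤s′) }) h
    ... | a , a<i , h₁ with uniform p (λ s≤s′ g d d<s → g d (<-≤-trans d<s s≤s′)) h₁
    -- Stage `suc d` is the first one that tests d.
    ... | c , _ , h₂ = a , a<i , c , λ d → h₂ (suc d) d (n<1+n d)

    -- The indices of the main language and of the collapsed attackers; `FullElement` describes the
    -- language that they share within a block.
    Full : ℕ → Set
    Full J = τ₂ J ≡ 0 ⊎ Collapsed x (τ₁ J) (τ₃ J)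

    FullElement : (β t u : ℕ) → Set
    FullElement β zero    u = ⊤
    FullElement β (suc _) u = Collapsed x β u

    full⁻ : ∀ J → Full J → ∀ t u → Element x (τ₁ J) (τ₂ J) (τ₃ J) t u → FullElement (τ₁ J) t u
    full⁻ J full zero u el = tt
    full⁻ J full (suc t) u (inj₁ col) = col
    full⁻ J (inj₁ t≡0) (suc t) u (inj₂ (t≢0 , _)) = contradiction t≡0 t≢0
    -- The private point of a collapsed attacker belongs to every language of the block.
    full⁻ J (inj₂ col) (suc t) u (inj₂ (_ , refl)) = col

    full⁺ : ∀ J → Full J → ∀ t u → FullElement (τ₁ J) t u → Element x (τ₁ J) (τ₂ J) (τ₃ J) t u
    full⁺ J (inj₁ t≡0) zero u el = inj₁ t≡0
    full⁺ J (inj₂ col) zero u el = inj₂ (inj₂ col)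
    full⁺ J full (suc t) u col = inj₁ col

    full-⊆ : ∀ {J J′} → Full J → Full J′ → τ₁ J ≡ τ₁ J′ → ∀ {y} → Member x J y → Member x J′ y
    full-⊆ {J} {J′} full full′ eq {y} (β≡ , el) = trans (sym eq) β≡ ,
      full⁺ J′ full′ (τ₂ y) (τ₃ y) (subst (λ β → FullElement β (τ₂ y) (τ₃ y)) eq (full⁻ J full (τ₂ y) (τ₃ y) el))

    -- Only whether t is 0 matters, so every attacker has infinitely many indices with the same
    -- language.
    attacker-⊆ : ∀ {β t t′ j} → t′ ≢ 0 → t ≢ 0 → ∀ t″ u → Element x β t j t″ u → Element x β t′ j t″ u
    attacker-⊆ t′≢0 t≢0 zero     u (inj₁ t≡0)       = contradiction t≡0 t≢0
    attacker-⊆ t′≢0 t≢0 zero     u (inj₂ el)        = inj₂ el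
    attacker-⊆ t′≢0 t≢0 (suc t″) u (inj₁ col)       = inj₁ col
    attacker-⊆ t′≢0 t≢0 (suc t″) u (inj₂ (_ , eq))  = inj₂ (t′≢0 , eq)

    member-⊆ : ∀ {J J′} → τ₁ J ≡ τ₁ J′ → τ₂ J ≢ 0 → τ₂ J′ ≢ 0 → τ₃ J ≡ τ₃ J′ →
               ∀ {y} → Member x J y → Member x J′ y
    member-⊆ {J} {J′} eq₁ t≢0 t′≢0 eq₃ {y} (β≡ , el) = trans (sym eq₁) β≡ ,
      attacker-⊆ t′≢0 t≢0 (τ₂ y) (τ₃ y)
        (subst₂ (λ β j → Element x β (τ₂ J) j (τ₂ y) (τ₃ y)) eq₁ eq₃ el)

    member-triple : ∀ J β t u → Member x J (triple β t u) ≡ (τ₁ J ≡ β × Element x (τ₁ J) (τ₂ J) (τ₃ J) t u)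
    member-triple J = τ-triple (λ β t u → τ₁ J ≡ β × Element x (τ₁ J) (τ₂ J) (τ₃ J) t u)

    triple⁻ : ∀ J β t u → Member x J (triple β t u) → τ₁ J ≡ β × Element x (τ₁ J) (τ₂ J) (τ₃ J) t u
    triple⁻ J β t u = subst id (member-triple J β t u)

    triple⁺ : ∀ J t u → Element x (τ₁ J) (τ₂ J) (τ₃ J) t u → Member x J (triple (τ₁ J) t u)
    triple⁺ J t u el = subst id (sym (member-triple J (τ₁ J) t u)) (refl , el)

    module _ (a : ℕ) (h : ∀ b → Q a b) where

      teach-full : ∀ J → Full J → TeachableWithin (Member x) (suc a) J
      teach-full J full = S , ≤-reflexive (length-applyUpTo point (suc a)) , S⊆L , λ { J′ (S⊆L′ , ≠) → ≠ (same J′ S⊆L′) }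
        where
        β = τ₁ J
        c = proj₁ (h (nth β a))
        point : ℕ → ℕ
        -- With second coordinate `suc c`, an attacker containing the point and avoiding its column
        -- has p > c.
        point i = triple β 0 ⟪ i , suc c ⟫
        S = applyUpTo point (suc a)
        S⊆L : All (Member x J) S
        S⊆L = applyUpTo⁺₁ point (suc a) λ {i} _ →
          triple⁺ J 0 ⟪ i , suc c ⟫ (full⁺ J full 0 ⟪ i , suc c ⟫ tt)
        same : ∀ J′ → All (Member x J′) S → Member x J′ ≐ Member x J
        same J′ S⊆L′ = λ y → mk⇔ (full-⊆ {J′} {J} full′ full β≡ {y}) (full-⊆ {J} {J′} full full′ (sym β≡) {y})
          where
          in-L′ : ∀ {i} → i < suc a → τ₁ J′ ≡ β × Element x (τ₁ J′) (τ₂ J′) (τ₃ J′) 0 ⟪ i , suc c ⟫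
          in-L′ i<1+a = triple⁻ J′ β 0 ⟪ _ , suc c ⟫ (applyUpTo⁻ point (suc a) S⊆L′ i<1+a)
          β≡ : τ₁ J′ ≡ β
          β≡ = proj₁ (in-L′ (s≤s z≤n))
          full′ : Full J′
          -- If `J′` were not full, every point of S would have to avoid its column; then i > a and
          -- p > c, and `h` collapses it after all.
          full′ = dne λ ¬full → ¬full (inj₂ (collapsed ¬full))
            where
            avoids : ¬ Full J′ → ∀ {i} → i < suc a → i ≢ τ₁ (τ₃ J′) × suc c ≤ τ₂ (τ₃ J′)
            avoids ¬full {i} i<1+a with proj₂ (in-L′ i<1+a)
            ... | inj₁ t≡0        = contradiction (inj₁ t≡0) ¬full
            ... | inj₂ (inj₂ col) = contradiction (inj₂ col) ¬full
            ... | inj₂ (inj₁ (ne , le)) = (λ eq → ne (trans (π₁-⟪⟫ i (suc c)) eq)) ,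
                                          subst (_≤ τ₂ (τ₃ J′)) (π₂-⟪⟫ i (suc c)) le
            collapsed : ¬ Full J′ → Collapsed x (τ₁ J′) (τ₃ J′)
            -- Were the column of `J′` at most a, the point of S in that very column would not avoid
            -- it.
            collapsed ¬full = a , ≰⇒> (λ i≤a → proj₁ (avoids ¬full (s≤s i≤a)) refl)
                            , c , proj₂ (avoids ¬full (n<1+n a))
                            , λ d _ → subst (λ β → ∃ λ e → r x a (nth β a) c d e ≡ 0) (sym β≡)
                                            (proj₂ (h (nth β a)) d)

      -- A language containing the private point belongs to the same attacker, unless that attacker
      -- has collapsed, which is excluded.
      teach-attacker : ∀ J → ¬ Full J → TeachableWithin (Member x) (suc a) J
      teach-attacker J ¬full = triple (τ₁ J) 1 (τ₃ J) ∷ [] , s≤s z≤n ,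
        triple⁺ J 1 (τ₃ J) (inj₂ (t≢0 , refl)) ∷ [] , λ { J′ (p ∷ [] , ≠) → ≠ (same J′ (triple⁻ J′ (τ₁ J) 1 (τ₃ J) p)) }
        where
        t≢0 : τ₂ J ≢ 0
        t≢0 t≡0 = ¬full (inj₁ t≡0)
        same : ∀ J′ → τ₁ J′ ≡ τ₁ J × Element x (τ₁ J′) (τ₂ J′) (τ₃ J′) 1 (τ₃ J) → Member x J′ ≐ Member x J
        same J′ (β≡ , inj₁ col) =
          contradiction (inj₂ (subst (λ β → Collapsed x β (τ₃ J)) β≡ col)) ¬full
        same J′ (β≡ , inj₂ (t′≢0 , eq)) =
          λ y → mk⇔ (member-⊆ {J′} {J} β≡ t′≢0 t≢0 (sym eq) {y})
                            (member-⊆ {J} {J′} (sym β≡) t≢0 t′≢0 eq {y})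

      teachable : ∀ J → TeachableWithin (Member x) (suc a) J
      teachable J with em {P = Full J}
      ... | yes full = teach-full J full
      ... | no ¬full = teach-attacker J ¬full

    collapses : ∀ k → (∀ J → TeachableWithin (Member x) k J) → ∀ β → ∃ λ i → i ≤ k × ∃ λ p → ∀ s → Collapse x β i p s
    collapses k h β with h (triple β 0 0)
    ... | S , |S|≤k , S⊆L , teaches = i , proj₁ (proj₂ i-missing) , p , λ s → dne λ ¬col →
      teaches (J s) (All.tabulate (in-attacker s) , λ same → ¬col (col s same))
      where
      J₀ = triple β 0 0
      column = λ y → π₁ (τ₃ y)
      i-missing : ∃ λ i → i ≤ k × i ∉ map column S
      i-missing = missing (map column S) (subst (_≤ k) (sym (length-map column S)) |S|≤k)
      i = proj₁ i-missing
      -- p depends on S alone, so the same i and p serve for every s.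
      p = proj₁ (bound (λ y → π₂ (τ₃ y)) S)
      J : ℕ → ℕ
      J s = triple β 1 (triple i p s)
      avoids : ∀ {y} → y ∈ S → column y ≢ i × π₂ (τ₃ y) ≤ p
      avoids y∈S = All.lookup (map⁻ (¬Any⇒All¬ (map column S) (proj₂ (proj₂ i-missing)))) y∈S ∘ sym ,
                   All.lookup (proj₂ (bound (λ y → π₂ (τ₃ y)) S)) y∈S
      shift : ∀ s y t u → column y ≢ i → π₂ (τ₃ y) ≤ p → u ≡ τ₃ y →
              Element x β 0 0 t u → Element x β 1 (triple i p s) t u
      shift s y zero u ne le refl el = inj₂ (inj₁
        (subst id (sym (τ-triple (λ i p _ → column y ≢ i × π₂ (τ₃ y) ≤ p) i p s)) (ne , le)))
      shift s y (suc t) u ne le eq (inj₁ col) = inj₁ col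
      shift s y (suc t) u ne le eq (inj₂ (0≢0 , _)) = contradiction refl 0≢0
      in-attacker : ∀ s {y} → y ∈ S → Member x (J s) y
      in-attacker s {y} y∈S = (subst id
        (sym (τ-triple (λ β t j → β ≡ τ₁ y × Element x β t j (τ₂ y) (τ₃ y)) β 1 (triple i p s)))
        (let β≡ , el = subst id
                         (τ-triple (λ β t j → β ≡ τ₁ y × Element x β t j (τ₂ y) (τ₃ y)) β 0 0)
                         (All.lookup S⊆L y∈S)
             ne , le = avoids y∈S
         in β≡ , shift s y (τ₂ y) (τ₃ y) ne le refl el))
      -- The attacker's own private point is transferred to the main language, which contains
      -- private points of collapsed attackers only.
      col : ∀ s → Member x (J s) ≐ Member x J₀ → Collapse x β i p s
      col s same = subst id (τ-triple (Collapse x β) i p s) (go (proj₂ z∈L₀))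
        where
        z = triple β 1 (triple i p s)
        z∈L : Member x (J s) z
        z∈L = (subst id
          (sym (trans (member-triple (J s) β 1 (triple i p s))
                      (τ-triple (λ β′ t j → β′ ≡ β × Element x β′ t j 1 (triple i p s)) β 1 (triple i p s))))
          (refl , inj₂ ((λ ()) , refl)))
        z∈L₀ : β ≡ β × Element x β 0 0 1 (triple i p s)
        z∈L₀ = subst id (τ-triple (λ β′ t j → β′ ≡ β × Element x β′ t j 1 (triple i p s)) β 0 0)
                     (triple⁻ J₀ β 1 (triple i p s) (to (same z) z∈L))
        go : Element x β 0 0 1 (triple i p s) → Collapsed x β (triple i p s)
        go (inj₁ c)         = c
        go (inj₂ (0≢0 , _)) = contradiction refl 0≢0

    reduction : (∃ λ a → ∀ b → Q a b) ⇔ I-TD⁺ (smn x)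
    reduction = mk⇔
      (λ { (a , h) → suc a , λ J → TeachableWithin⇒TD⁺≤ {Member x} (smn x) (L⇔Member x) {suc a} {J} (teachable a h J) })
      λ { (k , h) → dne λ ¬ex →
      -- Each a receives some b refuting Q(a,b), and β codes these for a < k. The pair produced by
      -- the collapse has a < i ≤ k, so it contradicts the choice of b.
      let counterexample = λ a → ¬∀⇒∃¬ λ all → ¬ex (a , all)
          β , eq          = tuple k (proj₁ ∘ counterexample)
          i , i≤k , p , g = collapses k (λ J → TD⁺≤⇒TeachableWithin {Member x} (smn x) (L⇔Member x) {k} {J} (h J)) β
          a , a<i , q     = Collapse⇒Q β i p g
      in proj₂ (counterexample a) (subst (Q a) (eq a (<-≤-trans a<i i≤k)) q) }

I-TD⁺-hard : ExcludedMiddle 0ℓ → ∀ (B : ℕ → Set) → Σ⁰₅ B → B ≤m I-TD⁺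
I-TD⁺-hard em B (c , total , B⇔) = smn , smn-recursive , λ x → mk⇔
  (λ b → to (reduction x) (let a , h = to (B⇔ x) b in
    a , λ b → let c′ , g = h b in c′ , λ d → let e , q = g d in e , to (Holds⇔sem R _) q))
  (λ p → from (B⇔ x) (let a , h = from (reduction x) p in
    a , λ b → let c′ , g = h b in c′ , λ d → let e , q = g d in e , from (Holds⇔sem R _) q))
  where
  R = total⇒Fn c total
  open Family R
  open Correctness em

theorem9 : ExcludedMiddle 0ℓ → Σ⁰₅-complete I-TD⁺
theorem9 em = I-TD⁺∈Σ⁰₅ em , I-TD⁺-hard em
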